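{- There exist a process template $P\in\mathcal{P}_u$ and parameterized topologies $\mathbf{G},\mathbf{H}$, which can be chosen to be computable sets of topologies, such that: (1) the parameterized model checking problem for $\mathbf{G}$, process $\{P\}$ and prenex indexed $\mathsf{LTL}\setminus\mathsf{X}$ specifications is undecidable; and (2) the parameterized model checking problem for $\mathbf{H}$, process $\{P\}$ and $2$-indexed $\mathsf{CTL}\setminus\mathsf{X}$ specifications is undecidable.
   Context: A process template $P\in\mathcal{P}_u$ is a finite LTS over atoms $\mathsf{AP}_{pr}$ with action labels $\Sigma_{int}\cup\{\mathsf{snd},\mathsf{rcv}\}$, states partitioned into nonempty token states $T$ and non-token states $N$, initial states $\{\iota_t,\iota_n\}$ ($\iota_t\in T,\iota_n\in N$), $\mathsf{snd}$-transitions $T\to N$, $\mathsf{rcv}$-transitions $N\to T$, internal transitions staying in $T$ or in $N$, every state having a successor, and every infinite action sequence in $(\Sigma_{int}^*\mathsf{snd}\Sigma_{int}^*\mathsf{rcv})^\omega\cup(\Sigma_{int}^*\mathsf{rcv}\Sigma_{int}^*\mathsf{snd})^\omega$. A topology is $G=(V,E,x)$, $V=[n]$, initial vertex $x$, irreflexive $E$; a parameterized topology is a countable set of topologies. The token-passing system $P^G$ has states $Q^V$, initial state with only $x$ holding the token ($x$ in $\iota_t$, others in $\iota_n$), labeling $p_i$ iff $p$ holds in the local state of $i$, internal transitions of single vertices and token-passing transitions along edges $(v,w)\in E$ (synchronous $\mathsf{snd}$ at $v$ and $\mathsf{rcv}$ at $w$). Prenex indexed $\mathsf{TL}$ formulas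 are $Q_1x_1\dots Q_kx_k.\varphi$ ($k\ge0$ arbitrary; $k$-indexed if exactly $k$ quantifiers) with index quantifiers $\forall/\exists$ over vertices (possibly restricted to named variables or to out-neighbours of a named vertex) and $\varphi\in\mathsf{TL}$ over atoms $p_{x_j}$; $P^G\models Q_1x_1\dots Q_kx_k.\varphi$ iff $Q_1g_1\in V_G\dots Q_kg_k\in V_G$: $P^G\models\varphi[p_{x_j}\mapsto p_{g_j}]$. $\mathsf{LTL}\setminus\mathsf{X}$, $\mathsf{CTL}\setminus\mathsf{X}$ denote those logics without the next-time operator. The PMCP for $\mathbf{G}$, process set $\mathcal{P}$ and formula class $\mathcal{F}$ is the problem: given $(\varphi,P)\in\mathcal{F}\times\mathcal{P}$, decide whether $P^G\models\varphi$ for all $G\in\mathbf{G}$. -}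

module Defs where

open import Data.Nat using (ℕ; zero; suc; _+_; _*_; _^_; _≤_; _<_)
open import Data.Fin using (Fin; toℕ; _≟_) renaming (zero to fzero; suc to fsuc)
open import Data.Vec using (Vec; []; _∷_; lookup)
open import Data.List using (List; map; allFin) renaming ([] to []ₗ; _∷_ to _∷ₗ_)
open import Data.List.Relation.Unary.Any using (Any)
open import Data.Bool using (Bool; true; false; if_then_else_)
open import Data.Product using (Σ; _×_; _,_)
open import Data.Sum using (_⊎_)
open import Data.Empty using (⊥)
open import Data.Unit using (⊤)
open import Relation.Nullary using (¬_; yes; no)
open import Relation.Binary.PropositionalEquality using (_≡_; _≢_)

data PR : ℕ → Set where
  zer  : ∀ {n} → PR n
  sucF : PR 1
  proj : ∀ {n} → Fin n → PR n
  comp : ∀ {m n} → PR m → Vec (PR n) m → PR n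
  prec : ∀ {n} → PR n → PR (suc (suc n)) → PR (suc n)
  mu   : ∀ {n} → PR (suc n) → PR n

mutual
  data _[_]⇓_ : ∀ {n} → PR n → Vec ℕ n → ℕ → Set where
    e-zer   : ∀ {n} {xs : Vec ℕ n} → zer [ xs ]⇓ 0
    e-suc   : ∀ {x} → sucF [ x ∷ [] ]⇓ suc x
    e-proj  : ∀ {n} {i : Fin n} {xs : Vec ℕ n} → proj i [ xs ]⇓ lookup xs i
    e-comp  : ∀ {m n} {f : PR m} {gs : Vec (PR n) m} {xs : Vec ℕ n} {ys : Vec ℕ m} {y : ℕ}
              → gs [ xs ]⇓* ys → f [ ys ]⇓ y → comp f gs [ xs ]⇓ y
    e-prec0 : ∀ {n} {f : PR n} {g : PR (suc (suc n))} {xs : Vec ℕ n} {y : ℕ}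
              → f [ xs ]⇓ y → prec f g [ 0 ∷ xs ]⇓ y
    e-precS : ∀ {n} {f : PR n} {g : PR (suc (suc n))} {xs : Vec ℕ n} {k r y : ℕ}
              → prec f g [ k ∷ xs ]⇓ r → g [ k ∷ r ∷ xs ]⇓ y → prec f g [ suc k ∷ xs ]⇓ y
    e-mu    : ∀ {n} {f : PR (suc n)} {xs : Vec ℕ n} {y : ℕ}
              → f [ y ∷ xs ]⇓ 0
              → (∀ z → z < y → Σ ℕ (λ c → f [ z ∷ xs ]⇓ suc c))
              → mu f [ xs ]⇓ y

  data _[_]⇓*_ : ∀ {m n} → Vec (PR n) m → Vec ℕ n → Vec ℕ m → Set where
    e-nil  : ∀ {n} {xs : Vec ℕ n} → [] [ xs ]⇓* []
    e-cons : ∀ {m n} {g : PR n} {gs : Vec (PR n) m} {xs : Vec ℕ n} {y : ℕ} {ys : Vec ℕ m}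
             → g [ xs ]⇓ y → gs [ xs ]⇓* ys → (g ∷ gs) [ xs ]⇓* (y ∷ ys)

ComputableOn : {X : Set} → (X → Set) → (X → ℕ) → (X → Set) → Set
ComputableOn {X} D enc S =
  Σ (PR 1) λ f → (x : X) → D x →
    (S x → f [ enc x ∷ [] ]⇓ 1) × (¬ S x → f [ enc x ∷ [] ]⇓ 0)

Computable : {X : Set} → (X → ℕ) → (X → Set) → Set
Computable enc S = ComputableOn (λ _ → ⊤) enc S

pair : ℕ → ℕ → ℕ
pair a b = 2 ^ a * suc (2 * b)

encList : List ℕ → ℕ
encList []ₗ = 0
encList (x ∷ₗ xs) = suc (pair x (encList xs))

data Act (m : ℕ) : Set where
  int : Fin m → Act m
  snd : Act m
  rcv : Act m

IsInt : ∀ {m} → Act m → Set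
IsInt (int _) = ⊤
IsInt snd = ⊥
IsInt rcv = ⊥

record Template : Set where
  field
    nQ    : ℕ
    nAP   : ℕ
    nInt  : ℕ
    isTok : Fin nQ → Bool
    lab   : Fin nQ → Fin nAP → Bool
    δ     : Fin nQ → Act nInt → Fin nQ → Bool
    ιt    : Fin nQ
    ιn    : Fin nQ

-- segment [s , e) of the action word a is in Σ_int* c₁ Σ_int* c₂
Seg : ∀ {m} → Act m → Act m → (ℕ → Act m) → ℕ → ℕ → Set
Seg c₁ c₂ a s e =
  Σ ℕ λ l → e ≡ suc l × a l ≡ c₂ ×
  Σ ℕ λ mid → s ≤ mid × mid < l × a mid ≡ c₁ ×
  ((i : ℕ) → s ≤ i → i < l → i ≢ mid → IsInt (a i))

-- a ∈ (Σ_int* c₁ Σ_int* c₂)^ω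
InBlocks : ∀ {m} → Act m → Act m → (ℕ → Act m) → Set
InBlocks c₁ c₂ a =
  Σ (ℕ → ℕ) λ b → b 0 ≡ 0 × ((k : ℕ) → Seg c₁ c₂ a (b k) (b (suc k)))

module _ (P : Template) where
  open Template P

  IsRun : (ℕ → Fin nQ) → (ℕ → Act nInt) → Set
  IsRun s a = (s 0 ≡ ιt ⊎ s 0 ≡ ιn) × ((i : ℕ) → δ (s i) (a i) (s (suc i)) ≡ true)

  InPu : Set
  InPu =
    (Σ (Fin nQ) λ q → isTok q ≡ true) ×
    (Σ (Fin nQ) λ q → isTok q ≡ false) ×
    isTok ιt ≡ true × isTok ιn ≡ false ×
    ((q q' : Fin nQ) → δ q snd q' ≡ true → isTok q ≡ true × isTok q' ≡ false) ×
    ((q q' : Fin nQ) → δ q rcv q' ≡ true → isTok q ≡ false × isTok q' ≡ true) ×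
    ((q q' : Fin nQ) (a : Fin nInt) → δ q (int a) q' ≡ true → isTok q ≡ isTok q') ×
    ((q : Fin nQ) → Σ (Act nInt) λ a → Σ (Fin nQ) λ q' → δ q a q' ≡ true) ×
    ((s : ℕ → Fin nQ) (a : ℕ → Act nInt) → IsRun s a →
       InBlocks snd rcv a ⊎ InBlocks rcv snd a)

record Topology : Set where
  field
    n      : ℕ
    E      : Fin n → Fin n → Bool
    irrefl : (v : Fin n) → E v v ≡ false
    x      : Fin n                   -- initial vertex

ParamTopology : Set₁
ParamTopology = Topology → Set

encTop : Topology → ℕ
encTop G = pair n (pair (toℕ x)
  (encList (map (λ v → encList (map (λ w → if E v w then 1 else 0) (allFin n))) (allFin n))))
  where open Topology G

data LTL (A : Set) : Set where
  tt   : LTL A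
  atom : A → LTL A
  neg  : LTL A → LTL A
  and  : LTL A → LTL A → LTL A
  U    : LTL A → LTL A → LTL A

data CTL (A : Set) : Set where
  tt   : CTL A
  atom : A → CTL A
  neg  : CTL A → CTL A
  and  : CTL A → CTL A → CTL A
  EU   : CTL A → CTL A → CTL A
  AU   : CTL A → CTL A → CTL A

module Sem {S : Set} (Step : S → S → Set) {A : Set} (I : A → S → Set) where

  IsPath : S → (ℕ → S) → Set
  IsPath s π = π 0 ≡ s × ((i : ℕ) → Step (π i) (π (suc i)))

  satL : (ℕ → S) → ℕ → LTL A → Set
  satL π i tt = ⊤
  satL π i (atom p) = I p (π i)
  satL π i (neg φ) = ¬ satL π i φ
  satL π i (and φ ψ) = satL π i φ × satL π i ψ
  satL π i (U φ ψ) =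
    Σ ℕ λ j → i ≤ j × satL π j ψ × ((k : ℕ) → i ≤ k → k < j → satL π k φ)

  satLsys : S → LTL A → Set
  satLsys s φ = (π : ℕ → S) → IsPath s π → satL π 0 φ

  satC : S → CTL A → Set
  satC s tt = ⊤
  satC s (atom p) = I p s
  satC s (neg φ) = ¬ satC s φ
  satC s (and φ ψ) = satC s φ × satC s ψ
  satC s (EU φ ψ) = Σ (ℕ → S) λ π → IsPath s π ×
    Σ ℕ λ j → satC (π j) ψ × ((k : ℕ) → k < j → satC (π k) φ)
  satC s (AU φ ψ) = (π : ℕ → S) → IsPath s π →
    Σ ℕ λ j → satC (π j) ψ × ((k : ℕ) → k < j → satC (π k) φ)

encLTL : {A : Set} → (A → ℕ) → LTL A → ℕ
encLTL e tt = pair 0 0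
encLTL e (atom p) = pair 1 (e p)
encLTL e (neg φ) = pair 2 (encLTL e φ)
encLTL e (and φ ψ) = pair 3 (pair (encLTL e φ) (encLTL e ψ))
encLTL e (U φ ψ) = pair 4 (pair (encLTL e φ) (encLTL e ψ))

encCTL : {A : Set} → (A → ℕ) → CTL A → ℕ
encCTL e tt = pair 0 0
encCTL e (atom p) = pair 1 (e p)
encCTL e (neg φ) = pair 2 (encCTL e φ)
encCTL e (and φ ψ) = pair 3 (pair (encCTL e φ) (encCTL e ψ))
encCTL e (EU φ ψ) = pair 4 (pair (encCTL e φ) (encCTL e ψ))
encCTL e (AU φ ψ) = pair 5 (pair (encCTL e φ) (encCTL e ψ))

-- Prenex indexed formulas.  Index variables are de Bruijn indices:
-- in context m, variable fzero is the most recently bound one.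

data Qu : Set where
  all∀ : Qu
  ex∃  : Qu

data Dom (m : ℕ) : Set where
  every  : Dom m
  among  : List (Fin m) → Dom m
  outOf  : Fin m → Dom m

data Indexed (B : ℕ → Set) : ℕ → Set where
  body  : ∀ {m} → B m → Indexed B m
  quant : ∀ {m} → Qu → Dom m → Indexed B (suc m) → Indexed B m

nq : ∀ {B m} → Indexed B m → ℕ
nq (body _) = 0
nq (quant _ _ φ) = suc (nq φ)

encDom : ∀ {m} → Dom m → ℕ
encDom every = pair 0 0
encDom (among js) = pair 1 (encList (map toℕ js))
encDom (outOf j) = pair 2 (toℕ j)

encQu : Qu → ℕ
encQu all∀ = 0
encQu ex∃ = 1

encIdx : ∀ {B} → (∀ {m} → B m → ℕ) → ∀ {m} → Indexed B m → ℕ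
encIdx e (body b) = pair 0 (e b)
encIdx e (quant q d φ) = pair 1 (pair (encQu q) (pair (encDom d) (encIdx e φ)))

extV : ∀ {m k} → Fin k → (Fin m → Fin k) → Fin (suc m) → Fin k
extV g ρ fzero = g
extV g ρ (fsuc j) = ρ j

noV : ∀ {k} → Fin 0 → Fin k
noV ()

module _ (G : Topology) where
  open Topology G

  InDom : ∀ {m} → Dom m → (Fin m → Fin n) → Fin n → Set
  InDom every ρ g = ⊤
  InDom (among js) ρ g = Any (λ j → ρ j ≡ g) js
  InDom (outOf j) ρ g = E (ρ j) g ≡ true

  satI : ∀ {B} → (∀ {m} → B m → (Fin m → Fin n) → Set)
       → ∀ {m} → Indexed B m → (Fin m → Fin n) → Set
  satI h (body b) ρ = h b ρ
  satI h (quant all∀ d φ) ρ = (g : Fin n) → InDom d ρ g → satI h φ (extV g ρ)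
  satI h (quant ex∃ d φ) ρ = Σ (Fin n) λ g → InDom d ρ g × satI h φ (extV g ρ)

module TPS (P : Template) (G : Topology) where
  open Template P
  open Topology G

  GState : Set
  GState = Fin n → Fin nQ

  initState : GState
  initState v with v ≟ x
  ... | yes _ = ιt
  ... | no  _ = ιn

  data Step (s s' : GState) : Set where
    internal : (v : Fin n) (a : Fin nInt) →
               δ (s v) (int a) (s' v) ≡ true →
               ((u : Fin n) → u ≢ v → s' u ≡ s u) → Step s s'
    pass     : (v w : Fin n) → E v w ≡ true →
               δ (s v) snd (s' v) ≡ true →
               δ (s w) rcv (s' w) ≡ true →
               ((u : Fin n) → u ≢ v → u ≢ w → s' u ≡ s u) → Step s s'

  Atom : ∀ {m} → (Fin m → Fin n) → Fin nAP × Fin m → GState → Set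
  Atom ρ (p , j) s = lab (s (ρ j)) p ≡ true

  ⊨LTL : Indexed (λ m → LTL (Fin nAP × Fin m)) 0 → Set
  ⊨LTL φ = satI G (λ b ρ → Sem.satLsys Step (Atom ρ) initState b) φ noV

  ⊨CTL : Indexed (λ m → CTL (Fin nAP × Fin m)) 0 → Set
  ⊨CTL φ = satI G (λ b ρ → Sem.satC Step (Atom ρ) initState b) φ noV

IdxLTL : ℕ → Set
IdxLTL a = Indexed (λ m → LTL (Fin a × Fin m)) 0

IdxCTL : ℕ → Set
IdxCTL a = Indexed (λ m → CTL (Fin a × Fin m)) 0

encAtom : ∀ {a m} → Fin a × Fin m → ℕ
encAtom (p , j) = pair (toℕ p) (toℕ j)

encIdxLTL : ∀ {a} → IdxLTL a → ℕ
encIdxLTL φ = encIdx (encLTL encAtom) φ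

encIdxCTL : ∀ {a} → IdxCTL a → ℕ
encIdxCTL φ = encIdx (encCTL encAtom) φ

PMCP-LTL : (P : Template) → ParamTopology → IdxLTL (Template.nAP P) → Set
PMCP-LTL P 𝐆 φ = (G : Topology) → 𝐆 G → TPS.⊨LTL P G φ

PMCP-CTL : (P : Template) → ParamTopology → IdxCTL (Template.nAP P) → Set
PMCP-CTL P 𝐇 φ = (G : Topology) → 𝐇 G → TPS.⊨CTL P G φ

UndecidableLTL : (P : Template) → ParamTopology → Set
UndecidableLTL P 𝐆 = ¬ Computable encIdxLTL (PMCP-LTL P 𝐆)

UndecidableCTL2 : (P : Template) → ParamTopology → Set
UndecidableCTL2 P 𝐇 = ¬ ComputableOn (λ φ → nq φ ≡ 2) encIdxCTL (PMCP-CTL P 𝐇)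

{-# OPTIONS --safe #-}
module Submission where

-- Both parts are direct diagonalisations.  The system of a memoryless relay process on G is
-- bisimilar to G.  For each k there is a formula φ k and a family of graphs with initial vertex x
-- (plus isolated vertices) such that, on the family, φ k fails exactly if x = k + 2.  Keep in 𝐆 only
-- those graphs with n vertices for which the program coded by x - 2 accepts the code of φ (x - 2)
-- within n steps.  A decider f would then be refuted by φ ⌜ f ⌝: this formula is valid on 𝐆 iff f
-- never accepts it.
-- For LTL the graphs are the cycles x → x - 1 → ⋯ → 0 → x, and φ k says that no walk from x returns
-- to x for the first time after k + 3 steps; one index variable per step is needed.
-- For CTL the graphs are the ladders x → x - 1 → ⋯ → 0 in which every v ≤ x - 2 also has an edge to
-- x if v is even and to x - 1 if v is odd.  Only x and x - 1 are named; nesting E[_U_] alternately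
-- towards x and x - 1 counts the rungs below x - 1.

open import Defs
open import Data.Bool using (Bool; true; false; if_then_else_)
open import Data.Empty using (⊥; ⊥-elim)
open import Data.Fin using (Fin; toℕ; #_; fromℕ; fromℕ<; inject₁) renaming (zero to fzero; suc to fsuc; _≟_ to _≟ᶠ_)
open import Data.Fin.Properties using (toℕ<n; toℕ-injective; toℕ-fromℕ; toℕ-fromℕ<; toℕ-inject₁)
open import Data.Fin.Relation.Unary.Top using (view; ‵fromℕ; ‵inj₁)
open import Data.List using (List; tabulate; allFin) renaming ([] to []ₗ; _∷_ to _∷ₗ_; map to mapₗ)
open import Data.List.Properties using (map-tabulate; map-cong; tabulate-cong; ∷-injective)
open import Data.Nat hiding (parity)
open import Data.Nat.Properties
open import Data.Product using (Σ; ∃; _×_; _,_; proj₁; proj₂)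
open import Data.Sum using (_⊎_; inj₁; inj₂) renaming (map to map⊎)
open import Data.Unit using (⊤)
open import Data.Vec using (Vec; []; _∷_; lookup) renaming (map to mapᵛ; tabulate to tabulateᵛ)
open import Data.Vec.Properties using (lookup-map)
open import Function using (_∘_; id)
open import Relation.Binary.PropositionalEquality
open import Relation.Nullary using (¬_; yes; no)

-- Total functions on numbers, bundled with programs that compute them

record Fn (n : ℕ) : Set where
  constructor mkFn
  field
    fun  : Vec ℕ n → ℕ
    prog : PR n
    ok   : ∀ xs → prog [ xs ]⇓ fun xs
open Fn

var : ∀ {n} → Fin n → Fn n
var i = mkFn (λ xs → lookup xs i) (proj i) (λ _ → e-proj)

zeroF : ∀ {n} → Fn n
zeroF = mkFn (λ _ → 0) zer (λ _ → e-zer)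

funs : ∀ {m n} → Vec (Fn n) m → Vec ℕ n → Vec ℕ m
funs []       xs = []
funs (g ∷ gs) xs = fun g xs ∷ funs gs xs

progs : ∀ {m n} → Vec (Fn n) m → Vec (PR n) m
progs []       = []
progs (g ∷ gs) = prog g ∷ progs gs

oks : ∀ {m n} (gs : Vec (Fn n) m) xs → progs gs [ xs ]⇓* funs gs xs
oks []       xs = e-nil
oks (g ∷ gs) xs = e-cons (ok g xs) (oks gs xs)

call : ∀ {m n} → Fn m → Vec (Fn n) m → Fn n
call f gs = mkFn (λ xs → fun f (funs gs xs)) (comp (prog f) (progs gs))
                 (λ xs → e-comp (oks gs xs) (ok f _))

sucFn : ∀ {n} → Fn n → Fn n
sucFn f = mkFn (λ xs → suc (fun f xs)) (comp sucF (prog f ∷ []))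
               (λ xs → e-comp (e-cons (ok f xs) e-nil) e-suc)

lit : ∀ {n} → ℕ → Fn n
lit zero    = zeroF
lit (suc k) = sucFn (lit k)

recur : ∀ {n} → Fn n → Fn (2 + n) → ℕ → Vec ℕ n → ℕ
recur f g zero    xs = fun f xs
recur f g (suc k) xs = fun g (k ∷ recur f g k xs ∷ xs)

recFn : ∀ {n} → Fn n → Fn (2 + n) → Fn (1 + n)
recFn f g = mkFn (λ { (k ∷ xs) → recur f g k xs }) (prec (prog f) (prog g))
                 (λ { (k ∷ xs) → go k xs })
  where
  go : ∀ k xs → prec (prog f) (prog g) [ k ∷ xs ]⇓ recur f g k xs
  go zero    xs = e-prec0 (ok f xs)
  go (suc k) xs = e-precS (go k xs) (ok g _)

-- Exchanges the function denoted by a composed program for a pointwise equal one, so that later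
-- proofs meet `_+_` or `pair` and not nested recursors.
as : ∀ {n} (f : Fn n) (h : Vec ℕ n → ℕ) → (∀ xs → fun f xs ≡ h xs) → Fn n
as f h eq = mkFn h (prog f) (λ xs → subst (prog f [ xs ]⇓_) (eq xs) (ok f xs))

on1 : (ℕ → ℕ) → Vec ℕ 1 → ℕ
on1 h (a ∷ []) = h a

on2 : (ℕ → ℕ → ℕ) → Vec ℕ 2 → ℕ
on2 h (a ∷ b ∷ []) = h a b

on3 : (ℕ → ℕ → ℕ → ℕ) → Vec ℕ 3 → ℕ
on3 h (a ∷ b ∷ c ∷ []) = h a b c

as1 : (f : Fn 1) (h : ℕ → ℕ) → (∀ a → fun f (a ∷ []) ≡ h a) → Fn 1
as1 f h eq = as f (on1 h) λ { (a ∷ []) → eq a }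

as2 : (f : Fn 2) (h : ℕ → ℕ → ℕ) → (∀ a b → fun f (a ∷ b ∷ []) ≡ h a b) → Fn 2
as2 f h eq = as f (on2 h) λ { (a ∷ b ∷ []) → eq a b }

as3 : (f : Fn 3) (h : ℕ → ℕ → ℕ → ℕ) → (∀ a b c → fun f (a ∷ b ∷ c ∷ []) ≡ h a b c) → Fn 3
as3 f h eq = as f (on3 h) λ { (a ∷ b ∷ c ∷ []) → eq a b c }

addFn : Fn 2
addFn = as2 (recFn (var (# 0)) (sucFn (var (# 1)))) _+_ go
  where
  go : ∀ a b → recur (var (# 0)) (sucFn (var (# 1))) a (b ∷ []) ≡ a + b
  go zero    b = refl
  go (suc a) b = cong suc (go a b)

infixl 6 _⊕_
_⊕_ : ∀ {n} → Fn n → Fn n → Fn n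
f ⊕ g = call addFn (f ∷ g ∷ [])

mulFn : Fn 2
mulFn = as2 (recFn zeroF (var (# 2) ⊕ var (# 1))) _*_ go
  where
  go : ∀ a b → recur zeroF (var (# 2) ⊕ var (# 1)) a (b ∷ []) ≡ a * b
  go zero    b = refl
  go (suc a) b = cong (b +_) (go a b)

predFn : Fn 1
predFn = as1 (recFn zeroF (var (# 0))) pred λ { zero → refl ; (suc _) → refl }

monusFn : Fn 2
-- `prec` recurses on its first argument but subtraction on its second, hence the swap.
monusFn = as2 (call (recFn (var (# 0)) (call predFn (var (# 1) ∷ []))) (var (# 1) ∷ var (# 0) ∷ []))
              _∸_ go
  where
  go : ∀ a b → recur (var (# 0)) (call predFn (var (# 1) ∷ [])) b (a ∷ []) ≡ a ∸ b
  go a zero    = refl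
  go a (suc b) = trans (cong pred (go a b)) (pred[m∸n]≡m∸[1+n] a b)

-- A numeric equality test: by `dist≡0` and `dist-refl` it vanishes exactly on equal arguments. Zero
-- counts as true, so sums of such tests are conjunctions.
dist : ℕ → ℕ → ℕ
dist a b = (a ∸ b) + (b ∸ a)

distFn : Fn 2
distFn = as2 (call monusFn (var (# 0) ∷ var (# 1) ∷ []) ⊕ call monusFn (var (# 1) ∷ var (# 0) ∷ []))
             dist (λ _ _ → refl)

dist≡0 : ∀ a b → dist a b ≡ 0 → a ≡ b
dist≡0 a b eq = ≤-antisym (m∸n≡0⇒m≤n (m+n≡0⇒m≡0 (a ∸ b) eq))
                          (m∸n≡0⇒m≤n (m+n≡0⇒n≡0 (a ∸ b) eq))

dist-refl : ∀ a → dist a a ≡ 0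
dist-refl a = cong₂ _+_ (n∸n≡0 a) (n∸n≡0 a)

cond : ℕ → ℕ → ℕ → ℕ
cond zero    a b = a
cond (suc _) a b = b

condFn : Fn 3
condFn = as3 (recFn (var (# 0)) (var (# 3))) cond λ { zero _ _ → refl ; (suc _) _ _ → refl }

infix 6 _⟨0⟩_∣_
_⟨0⟩_∣_ : ∀ {n} → Fn n → Fn n → Fn n → Fn n
f ⟨0⟩ g ∣ h = call condFn (f ∷ g ∷ h ∷ [])

-- Defs.pair and its projections.

-- With `pair-suc`, this presents 2^a (2b + 1) as `a` doublings of 2b + 1, the form in which
-- `pairFn` builds a pair and `strip` takes it apart.
pair-zero : ∀ b → pair 0 b ≡ suc (b + b)
pair-zero b = trans (*-identityˡ _) (cong (λ z → suc (b + z)) (+-identityʳ b))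

pair-suc : ∀ a b → pair (suc a) b ≡ pair a b + pair a b
pair-suc a b = trans (*-assoc 2 (2 ^ a) (suc (2 * b))) (cong (pair a b +_) (+-identityʳ _))

pairFn : Fn 2
pairFn = as2 (recFn (sucFn (var (# 0) ⊕ var (# 0))) (var (# 1) ⊕ var (# 1))) pair go
  where
  go : ∀ a b → recur (sucFn (var (# 0) ⊕ var (# 0))) (var (# 1) ⊕ var (# 1)) a (b ∷ []) ≡ pair a b
  go zero    b = sym (pair-zero b)
  go (suc a) b = trans (cong₂ _+_ (go a b) (go a b)) (sym (pair-suc a b))

infixr 5 _⊗_
_⊗_ : ∀ {n} → Fn n → Fn n → Fn n
f ⊗ g = call pairFn (f ∷ g ∷ [])

parity : ℕ → ℕ
parity zero    = 0
parity (suc n) = cond (parity n) 1 0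

parityFn : Fn 1
parityFn = as1 (recFn zeroF (var (# 1) ⟨0⟩ lit 1 ∣ lit 0)) parity go
  where
  go : ∀ a → recur zeroF (var (# 1) ⟨0⟩ lit 1 ∣ lit 0) a [] ≡ parity a
  go zero    = refl
  go (suc a) = cong (λ p → cond p 1 0) (go a)

half : ℕ → ℕ
half zero    = 0
half (suc n) = parity n + half n

halfFn : Fn 1
halfFn = as1 (recFn zeroF (call parityFn (var (# 0) ∷ []) ⊕ var (# 1))) half go
  where
  go : ∀ a → recur zeroF (call parityFn (var (# 0) ∷ []) ⊕ var (# 1)) a [] ≡ half a
  go zero    = refl
  go (suc a) = cong (parity a +_) (go a)

parity-double : ∀ m → parity (m + m) ≡ 0
parity-double zero = refl
parity-double (suc m) rewrite +-suc m m | parity-double m = refl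

half-double : ∀ m → half (m + m) ≡ m
half-double zero = refl
half-double (suc m) rewrite +-suc m m | parity-double m | half-double m = refl

-- Strips one factor 2; 0 and the odd numbers are fixed.
strip : ℕ → ℕ
strip c = cond (parity c) (half c) c

stripFn : Fn 1
stripFn = as1 (call parityFn (var (# 0) ∷ []) ⟨0⟩ call halfFn (var (# 0) ∷ []) ∣ var (# 0)) strip (λ _ → refl)

strips : ℕ → ℕ → ℕ
strips zero    c = c
strips (suc i) c = strip (strips i c)

stripsFn : Fn 2
stripsFn = as2 (recFn (var (# 0)) (call stripFn (var (# 1) ∷ []))) strips go
  where
  go : ∀ i c → recur (var (# 0)) (call stripFn (var (# 1) ∷ [])) i (c ∷ []) ≡ strips i c
  go zero    c = refl
  go (suc i) c = cong strip (go i c)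

-- On `pair a b` the iterates of `strip` stay even until all `a` factors 2 are gone, so counting the
-- even ones among the first `i` yields the exponent once `i ≥ a`.
evens : ℕ → ℕ → ℕ
evens zero    c = 0
evens (suc i) c = cond (parity (strips i c)) (suc (evens i c)) (evens i c)

evensFn : Fn 2
evensFn = as2 (recFn zeroF step) evens go
  where
  step : Fn 3
  step = call parityFn (call stripsFn (var (# 0) ∷ var (# 2) ∷ []) ∷ []) ⟨0⟩ sucFn (var (# 1)) ∣ var (# 1)
  go : ∀ i c → recur zeroF step i (c ∷ []) ≡ evens i c
  go zero    c = refl
  go (suc i) c = cong (λ r → cond (parity (strips i c)) (suc r) r) (go i c)

-- A pair exceeds its first component (`m<pair`), so its own value can serve as the number of
-- strippings. Both projections send 0 to 0, as `car` and `cdr` send a leaf to a leaf.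
first : ℕ → ℕ
first c = cond c 0 (evens c c)

second : ℕ → ℕ
second c = half (strips c c)

firstFn : Fn 1
firstFn = as1 (var (# 0) ⟨0⟩ zeroF ∣ call evensFn (var (# 0) ∷ var (# 0) ∷ [])) first (λ _ → refl)

secondFn : Fn 1
secondFn = as1 (call halfFn (call stripsFn (var (# 0) ∷ var (# 0) ∷ []) ∷ [])) second (λ _ → refl)

parity-pair0 : ∀ b → parity (pair 0 b) ≡ 1
parity-pair0 b = trans (cong parity (pair-zero b)) (cong (λ p → cond p 1 0) (parity-double b))

parity-pair-suc : ∀ a b → parity (pair (suc a) b) ≡ 0
parity-pair-suc a b = trans (cong parity (pair-suc a b)) (parity-double (pair a b))

strip-pair : ∀ a b → strip (pair a b) ≡ pair (pred a) b
strip-pair zero b = cong (λ p → cond p (half (pair 0 b)) (pair 0 b)) (parity-pair0 b)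
strip-pair (suc a) b =
  trans (cong (λ p → cond p (half (pair (suc a) b)) (pair (suc a) b)) (parity-pair-suc a b))
        (trans (cong half (pair-suc a b)) (half-double (pair a b)))

strips-pair : ∀ i a b → strips i (pair a b) ≡ pair (a ∸ i) b
strips-pair zero    a b = refl
strips-pair (suc i) a b =
  trans (cong strip (strips-pair i a b))
        (trans (strip-pair (a ∸ i) b) (cong (λ k → pair k b) (pred[m∸n]≡m∸[1+n] a i)))

-- An invariant of the stripping: factors counted plus factors left make `a`. Truncated subtraction
-- keeps it true after the last factor is gone.
evens-pair : ∀ i a b → evens i (pair a b) + (a ∸ i) ≡ a
evens-pair zero    a b = refl
evens-pair (suc i) a b =
  trans (cong₂ (λ s d → cond (parity s) (suc (evens i (pair a b))) (evens i (pair a b)) + d)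
               (strips-pair i a b) (sym (pred[m∸n]≡m∸[1+n] a i)))
        (count (a ∸ i) (evens-pair i a b))
  where
  count : ∀ d {e} → e + d ≡ a → cond (parity (pair d b)) (suc e) e + pred d ≡ a
  count zero    {e} eq = trans (cong (λ p → cond p (suc e) e + 0) (parity-pair0 b)) eq
  count (suc d) {e} eq = trans (cong (λ p → cond p (suc e) e + d) (parity-pair-suc d b))
                               (trans (sym (+-suc e d)) eq)

m<pair : ∀ a b → a < pair a b
m<pair zero    b = subst (0 <_) (sym (pair-zero b)) (s≤s z≤n)
m<pair (suc a) b = subst (suc a <_) (sym (pair-suc a b))
                         (+-mono-≤ (≤-trans (s≤s z≤n) (m<pair a b)) (m<pair a b))

private
  stripped : ∀ a b → a ∸ pair a b ≡ 0
  stripped a b = m≤n⇒m∸n≡0 (<⇒≤ (m<pair a b))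

first-pair : ∀ a b → first (pair a b) ≡ a
first-pair a b = trans (nonzero (pair a b) (m<pair a b)) counted
  where
  nonzero : ∀ c → a < c → first c ≡ evens c c
  nonzero (suc c) _ = refl
  counted : evens (pair a b) (pair a b) ≡ a
  counted = trans (sym (+-identityʳ _))
                  (trans (cong (evens (pair a b) (pair a b) +_) (sym (stripped a b)))
                         (evens-pair (pair a b) a b))

second-pair : ∀ a b → second (pair a b) ≡ b
second-pair a b =
  trans (cong half (trans (strips-pair (pair a b) a b)
                          (trans (cong (λ k → pair k b) (stripped a b)) (pair-zero b))))
        (trans (cong (_+ half (b + b)) (parity-double b)) (half-double b))

pair-injective : ∀ {a b c d} → pair a b ≡ pair c d → a ≡ c × b ≡ d
pair-injective {a} {b} {c} {d} eq =
  trans (sym (first-pair a b)) (trans (cong first eq) (first-pair c d)) ,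
  trans (sym (second-pair a b)) (trans (cong second eq) (second-pair c d))

-- Binary trees, their codes and programs on them

data Tree : Set where
  leaf : Tree
  node : Tree → Tree → Tree

-- Since `pair` is never 0, the leaf can be coded by 0: a test for 0 then tells leaves from nodes,
-- and distinct trees get distinct codes.
code : Tree → ℕ
code leaf       = 0
code (node s t) = pair (code s) (code t)

car cdr : Tree → Tree
car leaf       = leaf
car (node s _) = s
cdr leaf       = leaf
cdr (node _ t) = t

ifLeaf : Tree → Tree → Tree → Tree
ifLeaf leaf       s t = s
ifLeaf (node _ _) s t = t

-- A loop-free language for tree functions. The single induction `treeFn-code` compiles all of it to
-- arithmetic on codes, so the machine below can be described and verified on trees.
data TExp (n : ℕ) : Set where
  varᵉ      : Fin n → TExp n
  leafᵉ     : TExp n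
  nodeᵉ     : TExp n → TExp n → TExp n
  carᵉ cdrᵉ : TExp n → TExp n
  ifᵉ       : TExp n → TExp n → TExp n → TExp n

⟦_⟧ : ∀ {n} → TExp n → Vec Tree n → Tree
⟦ varᵉ i ⟧    ρ = lookup ρ i
⟦ leafᵉ ⟧     ρ = leaf
⟦ nodeᵉ a b ⟧ ρ = node (⟦ a ⟧ ρ) (⟦ b ⟧ ρ)
⟦ carᵉ a ⟧    ρ = car (⟦ a ⟧ ρ)
⟦ cdrᵉ a ⟧    ρ = cdr (⟦ a ⟧ ρ)
⟦ ifᵉ c a b ⟧ ρ = ifLeaf (⟦ c ⟧ ρ) (⟦ a ⟧ ρ) (⟦ b ⟧ ρ)

treeFn : ∀ {n} → TExp n → Fn n
treeFn (varᵉ i)    = var i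
treeFn leafᵉ       = zeroF
treeFn (nodeᵉ a b) = treeFn a ⊗ treeFn b
treeFn (carᵉ a)    = call firstFn (treeFn a ∷ [])
treeFn (cdrᵉ a)    = call secondFn (treeFn a ∷ [])
treeFn (ifᵉ c a b) = treeFn c ⟨0⟩ treeFn a ∣ treeFn b

cond-pair : ∀ a b x y → cond (pair a b) x y ≡ y
cond-pair a b x y with pair a b | m<pair a b
... | suc _ | _ = refl

treeFn-code : ∀ {n} (e : TExp n) ρ → fun (treeFn e) (mapᵛ code ρ) ≡ code (⟦ e ⟧ ρ)
treeFn-code (varᵉ i)    ρ = lookup-map i code ρ
treeFn-code leafᵉ       ρ = refl
treeFn-code (nodeᵉ a b) ρ = cong₂ pair (treeFn-code a ρ) (treeFn-code b ρ)
treeFn-code (carᵉ a)    ρ = trans (cong first (treeFn-code a ρ)) (first-code (⟦ a ⟧ ρ))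
  where
  first-code : ∀ t → first (code t) ≡ code (car t)
  first-code leaf       = refl
  first-code (node s t) = first-pair (code s) (code t)
treeFn-code (cdrᵉ a)    ρ = trans (cong second (treeFn-code a ρ)) (second-code (⟦ a ⟧ ρ))
  where
  second-code : ∀ t → second (code t) ≡ code (cdr t)
  second-code leaf       = refl
  second-code (node s t) = second-pair (code s) (code t)
treeFn-code (ifᵉ c a b) ρ =
  trans (cong₂ (λ x y → cond x y _) (treeFn-code c ρ) (treeFn-code a ρ))
        (trans (cong (cond (code (⟦ c ⟧ ρ)) (code (⟦ a ⟧ ρ))) (treeFn-code b ρ)) (cond-code (⟦ c ⟧ ρ)))
  where
  cond-code : ∀ t → cond (code t) (code (⟦ a ⟧ ρ)) (code (⟦ b ⟧ ρ)) ≡ code (ifLeaf t (⟦ a ⟧ ρ) (⟦ b ⟧ ρ))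
  cond-code leaf       = refl
  cond-code (node s t) = cond-pair (code s) (code t) _ _

-- An abstract machine for PR.  A state node (node p xs) K evaluates the program p on xs with
-- continuation stack K; p = leaf means that the value xs is returned to K.

num : ℕ → Tree
num zero    = leaf
num (suc k) = node leaf (num k)

nums : ∀ {n} → Vec ℕ n → Tree
nums []       = leaf
nums (x ∷ xs) = node (num x) (nums xs)

mutual
  ⌜_⌝ : ∀ {n} → PR n → Tree
  ⌜ zer ⌝       = node (num 0) leaf
  ⌜ sucF ⌝      = node (num 1) leaf
  ⌜ proj i ⌝    = node (num 2) (num (toℕ i))
  ⌜ comp f gs ⌝ = node (num 3) (node ⌜ f ⌝ ⌜ gs ⌝*)
  ⌜ prec f g ⌝  = node (num 4) (node ⌜ f ⌝ ⌜ g ⌝)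
  ⌜ mu f ⌝      = node (num 5) ⌜ f ⌝

  ⌜_⌝* : ∀ {m n} → Vec (PR n) m → Tree
  ⌜ [] ⌝*     = leaf
  ⌜ g ∷ gs ⌝* = node ⌜ g ⌝ ⌜ gs ⌝*

eval : Tree → Tree → Tree → Tree
eval p xs K = node (node p xs) K

ret : Tree → Tree → Tree
ret = eval leaf

args : Tree → Tree
args gs = node (num 6) gs

muK : Tree → Tree → Tree → Tree
muK f z xs = node (num 1) (node f (node z xs))

private
  numᵉ : ∀ {n} → ℕ → TExp n
  numᵉ zero    = leafᵉ
  numᵉ (suc k) = nodeᵉ leafᵉ (numᵉ k)

  evalᵉ : ∀ {n} → TExp n → TExp n → TExp n → TExp n
  evalᵉ p xs K = nodeᵉ (nodeᵉ p xs) K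

  -- Tags are unary numerals (`num`), so `cdr` counts a tag down until its branch is reached.
  caseᵉ : ∀ {n k} → TExp n → Vec (TExp n) k → TExp n
  caseᵉ t []       = leafᵉ
  caseᵉ t (e ∷ es) = ifᵉ t e (caseᵉ (cdrᵉ t) es)

-- The branches of run follow the tags of ⌜_⌝ and args; those of continue are the frames pushed by
-- prec, mu, args (twice) and comp.
stepᵉ : TExp 1
stepᵉ = ifᵉ p (ifᵉ K state continue) run
  where
  state p xs K arg frame rest : TExp 1
  state = varᵉ fzero
  p     = carᵉ (carᵉ state)
  xs    = cdrᵉ (carᵉ state)
  K     = cdrᵉ state
  arg   = cdrᵉ p
  frame = cdrᵉ (carᵉ K)
  rest  = cdrᵉ K
  run : TExp 1
  run = caseᵉ (carᵉ p)
    ( evalᵉ leafᵉ leafᵉ K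
    ∷ evalᵉ leafᵉ (nodeᵉ leafᵉ (carᵉ xs)) K
    ∷ ifᵉ arg (evalᵉ leafᵉ (carᵉ xs) K) (evalᵉ (nodeᵉ (numᵉ 2) (cdrᵉ arg)) (cdrᵉ xs) K)
    ∷ evalᵉ (nodeᵉ (numᵉ 6) (cdrᵉ arg)) xs (nodeᵉ (nodeᵉ (numᵉ 4) (carᵉ arg)) K)
    ∷ ifᵉ (carᵉ xs) (evalᵉ (carᵉ arg) (cdrᵉ xs) K)
          (evalᵉ p (nodeᵉ (cdrᵉ (carᵉ xs)) (cdrᵉ xs))
                 (nodeᵉ (nodeᵉ (numᵉ 0) (nodeᵉ (cdrᵉ arg) (nodeᵉ (cdrᵉ (carᵉ xs)) (cdrᵉ xs)))) K))
    ∷ evalᵉ arg (nodeᵉ leafᵉ xs) (nodeᵉ (nodeᵉ (numᵉ 1) (nodeᵉ arg (nodeᵉ leafᵉ xs))) K)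
    ∷ ifᵉ arg (evalᵉ leafᵉ leafᵉ K)
          (evalᵉ (carᵉ arg) xs (nodeᵉ (nodeᵉ (numᵉ 2) (nodeᵉ (cdrᵉ arg) xs)) K))
    ∷ [])
  continue : TExp 1
  continue = caseᵉ (carᵉ (carᵉ K))
    ( evalᵉ (carᵉ frame) (nodeᵉ (carᵉ (cdrᵉ frame)) (nodeᵉ xs (cdrᵉ (cdrᵉ frame)))) rest
    ∷ ifᵉ xs (evalᵉ leafᵉ (carᵉ (cdrᵉ frame)) rest)
          (evalᵉ (carᵉ frame) (nodeᵉ (nodeᵉ leafᵉ (carᵉ (cdrᵉ frame))) (cdrᵉ (cdrᵉ frame)))
                 (nodeᵉ (nodeᵉ (numᵉ 1) (nodeᵉ (carᵉ frame)
                          (nodeᵉ (nodeᵉ leafᵉ (carᵉ (cdrᵉ frame))) (cdrᵉ (cdrᵉ frame))))) rest))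
    ∷ evalᵉ (nodeᵉ (numᵉ 6) (carᵉ frame)) (cdrᵉ frame) (nodeᵉ (nodeᵉ (numᵉ 3) xs) rest)
    ∷ evalᵉ leafᵉ (nodeᵉ frame xs) rest
    ∷ evalᵉ frame xs rest
    ∷ [])

step : Tree → Tree
step s = ⟦ stepᵉ ⟧ (s ∷ [])

infix 4 _⟶*_
data _⟶*_ : Tree → Tree → Set where
  done : ∀ {s} → s ⟶* s
  more : ∀ {s t} → step s ⟶* t → s ⟶* t

infixr 5 _then_
_then_ : ∀ {s t u} → s ⟶* t → t ⟶* u → s ⟶* u
done   then q = q
more p then q = more (p then q)

proj-run : ∀ {n} (i : Fin n) xs K → eval ⌜ proj i ⌝ (nums xs) K ⟶* ret (num (lookup xs i)) K
proj-run fzero    (x ∷ xs) K = more done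
proj-run (fsuc i) (x ∷ xs) K = more (proj-run i xs K)

-- Induction on the number `d` of candidates from `z` up to the least zero `y`. A nonzero value
-- makes the frame `muK` restart with `z + 1`; the value 0 at `y` makes it return `y`.
mu-run : ∀ {n} (f : PR (suc n)) (xs : Vec ℕ n) y K →
         eval ⌜ f ⌝ (nums (y ∷ xs)) (node (muK ⌜ f ⌝ (num y) (nums xs)) K)
           ⟶* ret leaf (node (muK ⌜ f ⌝ (num y) (nums xs)) K) →
         (∀ z → z < y → ∀ K' → ∃ λ c → eval ⌜ f ⌝ (nums (z ∷ xs)) K' ⟶* ret (num (suc c)) K') →
         ∀ d z → d + z ≡ y →
         eval ⌜ f ⌝ (nums (z ∷ xs)) (node (muK ⌜ f ⌝ (num z) (nums xs)) K) ⟶* ret (num y) K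
mu-run f xs y K last before zero    .y refl = last then more done
mu-run f xs y K last before (suc d) z  eq =
  proj₂ (before z (subst (z <_) eq (s≤s (m≤n+m z d))) _) then
  more (mu-run f xs y K last before d (suc z) (trans (+-suc d z) eq))

mutual
  -- Induction on the derivation. The stack `K` is arbitrary because subprograms run on top of the
  -- frames of their callers. Each machine step holds by computation, so only the order of calls and
  -- returns is spelled out.
  ⇓-run : ∀ {n} {f : PR n} {xs y} → f [ xs ]⇓ y → ∀ K → eval ⌜ f ⌝ (nums xs) K ⟶* ret (num y) K
  ⇓-run e-zer         K = more done
  ⇓-run e-suc         K = more done
  ⇓-run (e-proj {i = i} {xs = xs}) K = proj-run i xs K
  ⇓-run (e-comp ds d) K = more (⇓*-run ds _ then more (⇓-run d K))
  ⇓-run (e-prec0 d)   K = more (⇓-run d K)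
  ⇓-run (e-precS d e) K = more (⇓-run d _ then more (⇓-run e K))
  ⇓-run (e-mu {f = f} {xs = xs} {y = y} d h) K =
    more (mu-run f xs y K (⇓-run d _) (λ z z<y K' → proj₁ (h z z<y) , ⇓-run (proj₂ (h z z<y)) K')
                 y 0 (+-identityʳ y))

  ⇓*-run : ∀ {m n} {gs : Vec (PR n) m} {xs ys} → gs [ xs ]⇓* ys →
           ∀ K → eval (args ⌜ gs ⌝*) (nums xs) K ⟶* ret (nums ys) K
  ⇓*-run e-nil         K = more done
  ⇓*-run (e-cons d ds) K = more (⇓-run d _ then more (⇓*-run ds _ then more done))

-- Halting runs and their simulation on codes

steps : ℕ → Tree → Tree
steps zero    s = s
steps (suc k) s = step (steps k s)

steps-step : ∀ k s → steps k (step s) ≡ step (steps k s)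
steps-step zero    s = refl
steps-step (suc k) s = cong step (steps-step k s)

⟶*-steps : ∀ {s t} → s ⟶* t → ∃ λ k → steps k s ≡ t
⟶*-steps done = 0 , refl
⟶*-steps {s} (more r) with ⟶*-steps r
... | k , eq = suc k , trans (sym (steps-step k s)) eq

halt : ℕ → Tree
halt y = ret (num y) leaf

-- `step` fixes a state with nothing to evaluate and an empty stack. Hence halting within `l` steps
-- can be tested at step `l` alone.
steps-halt : ∀ {s k l y} → steps k s ≡ halt y → k ≤ l → steps l s ≡ halt y
steps-halt {s} {k} {l} {y} eq k≤l = subst (λ m → steps m s ≡ halt y) (m∸n+n≡m k≤l) (go (l ∸ k))
  where
  go : ∀ d → steps (d + k) s ≡ halt y
  go zero    = eq
  go (suc d) = cong step (go d)

-- Both runs are prolonged to the common length `k + l`.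
halt-unique : ∀ {s k l y z} → steps k s ≡ halt y → steps l s ≡ halt z → num y ≡ num z
halt-unique {s} {k} {l} p q =
  cong (λ t → cdr (car t)) (trans (sym (steps-halt p (m≤m+n k l))) (steps-halt q (m≤n+m l k)))

initial : Tree → ℕ → Tree
initial p i = eval p (node (num i) leaf) leaf

⇓-steps : ∀ {f : PR 1} {i y} → f [ i ∷ [] ]⇓ y → ∃ λ k → steps k (initial ⌜ f ⌝ i) ≡ halt y
⇓-steps d = ⟶*-steps (⇓-run d leaf)

numFn : Fn 1
numFn = as1 (recFn zeroF (zeroF ⊗ var (# 1))) (λ k → code (num k)) go
  where
  go : ∀ k → recur zeroF (zeroF ⊗ var (# 1)) k [] ≡ code (num k)
  go zero    = refl
  go (suc k) = cong (pair 0) (go k)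

startFn : Fn 2
startFn = as2 ((var (# 0) ⊗ (call numFn (var (# 1) ∷ []) ⊗ zeroF)) ⊗ zeroF)
              (λ p i → pair (pair p (pair (code (num i)) 0)) 0) (λ _ _ → refl)

opaque
  stepFn : Fn 1
  stepFn = treeFn stepᵉ

  stepFn-code : ∀ s → fun stepFn (code s ∷ []) ≡ code (step s)
  stepFn-code s = treeFn-code stepᵉ (s ∷ [])

runNum : ℕ → ℕ → ℕ → ℕ
runNum zero    p i = fun startFn (p ∷ i ∷ [])
runNum (suc k) p i = fun stepFn (runNum k p i ∷ [])

runFn : Fn 3
runFn = as3 (recFn startFn next′) runNum go
  where
  next′ : Fn 4
  next′ = call stepFn (var (# 1) ∷ [])
  go : ∀ k p i → recur startFn next′ k (p ∷ i ∷ []) ≡ runNum k p i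
  go zero    p i = refl
  go (suc k) p i = cong (λ s → fun stepFn (s ∷ [])) (go k p i)

runNum-code : ∀ k t i → runNum k (code t) i ≡ code (steps k (initial t i))
runNum-code zero    t i = refl
runNum-code (suc k) t i = trans (cong (λ s → fun stepFn (s ∷ [])) (runNum-code k t i))
                                (stepFn-code (steps k (initial t i)))

code-injective : ∀ s t → code s ≡ code t → s ≡ t
code-injective leaf       leaf       eq = refl
code-injective leaf       (node t u) eq = ⊥-elim (n≮0 (subst (code t <_) (sym eq) (m<pair (code t) (code u))))
code-injective (node s r) leaf       eq = ⊥-elim (n≮0 (subst (code s <_) eq (m<pair (code s) (code r))))
code-injective (node s r) (node t u) eq with pair-injective eq
... | p , q = cong₂ node (code-injective s t p) (code-injective r u q)

-- Adjacency matrices.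

listFrom : (ℕ → ℕ) → ℕ → ℕ → List ℕ
listFrom h s zero    = []ₗ
listFrom h s (suc k) = h s ∷ₗ listFrom h (suc s) k

tabulate-listFrom : ∀ h s k → tabulate {n = k} (λ i → h (s + toℕ i)) ≡ listFrom h s k
tabulate-listFrom h s zero    = refl
tabulate-listFrom h s (suc k) =
  cong₂ _∷ₗ_ (cong h (+-identityʳ s))
    (trans (tabulate-cong (λ i → cong h (+-suc s (toℕ i)))) (tabulate-listFrom h (suc s) k))

-- Primitive recursion produces the list from its last entry to its first: round `k` prepends the
-- entry of index `n ∸ suc k`. So `n` enters twice, as the number of rounds and as a parameter.
tableFn : ∀ {m} → Fn (suc m) → Fn (suc m)
tableFn {m} g = as (call (recFn zeroF item) (var (# 0) ∷ vars)) table correct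
  where
  vars : Vec (Fn (suc m)) (suc m)
  vars = tabulateᵛ var
  item : Fn (3 + m)
  item = sucFn (call g (call monusFn (var (# 2) ∷ sucFn (var (# 0)) ∷ []) ∷
                        tabulateᵛ (λ i → var (fsuc (fsuc (fsuc i)))))
                ⊗ var (# 1))
  table : Vec ℕ (suc m) → ℕ
  table (n ∷ ys) = encList (listFrom (λ i → fun g (i ∷ ys)) 0 n)
  lookups : ∀ {l k} (f : Fin l → Fn k) xs zs → (∀ i → fun (f i) xs ≡ lookup zs i) →
            funs (tabulateᵛ f) xs ≡ zs
  lookups f xs []       eq = refl
  lookups f xs (z ∷ zs) eq = cong₂ _∷_ (eq fzero) (lookups (f ∘ fsuc) xs zs (eq ∘ fsuc))
  go : ∀ k n ys → k ≤ n → recur zeroF item k (n ∷ ys) ≡ encList (listFrom (λ i → fun g (i ∷ ys)) (n ∸ k) k)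
  go zero    n ys k≤n = refl
  go (suc k) n ys k<n =
    cong suc (cong₂ pair
      (cong (λ zs → fun g ((n ∸ suc k) ∷ zs)) (lookups _ _ ys (λ _ → refl)))
      (trans (go k n ys (<⇒≤ k<n))
             (cong (λ s → encList (listFrom (λ i → fun g (i ∷ ys)) s k)) (+-∸-assoc 1 k<n))))
  correct : ∀ xs → fun (call (recFn zeroF item) (var (# 0) ∷ vars)) xs ≡ table xs
  correct (n ∷ ys) =
    trans (cong (recur zeroF item n) (lookups var (n ∷ ys) (n ∷ ys) (λ _ → refl)))
          (trans (go n n ys ≤-refl)
                 (cong (λ s → encList (listFrom (λ i → fun g (i ∷ ys)) s n)) (n∸n≡0 n)))

fun-tableFn : ∀ {m} (g : Fn (suc m)) n ys →
              fun (tableFn g) (n ∷ ys) ≡ encList (mapₗ (λ i → fun g (toℕ i ∷ ys)) (allFin n))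
fun-tableFn g n ys = cong encList (sym (trans (map-tabulate {n = n} id (λ i → fun g (toℕ i ∷ ys)))
                                              (tabulate-listFrom (λ i → fun g (i ∷ ys)) 0 n)))

encList-injective : ∀ xs ys → encList xs ≡ encList ys → xs ≡ ys
encList-injective []ₗ       []ₗ       eq = refl
encList-injective (x ∷ₗ xs) (y ∷ₗ ys) eq with pair-injective (suc-injective eq)
... | p , q = cong₂ _∷ₗ_ p (encList-injective xs ys q)

tabulate-injective : ∀ {n} {f g : Fin n → ℕ} → tabulate f ≡ tabulate g → ∀ i → f i ≡ g i
tabulate-injective eq fzero    = proj₁ (∷-injective eq)
tabulate-injective eq (fsuc i) = tabulate-injective (proj₂ (∷-injective eq)) i

encList-map-injective : ∀ {n} (f g : Fin n → ℕ) → encList (mapₗ f (allFin n)) ≡ encList (mapₗ g (allFin n)) →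
                        ∀ i → f i ≡ g i
encList-map-injective f g eq =
  tabulate-injective (trans (sym (map-tabulate id f))
                            (trans (encList-injective _ _ eq) (map-tabulate id g)))

-- Decidable families of topologies

bit : ℕ → ℕ
bit k = cond k 1 0

isZero : ℕ → Bool
isZero zero    = true
isZero (suc _) = false

bit-if : ∀ k → (if isZero k then 1 else 0) ≡ bit k
bit-if zero    = refl
bit-if (suc _) = refl

bit-sound : ∀ b k → (if b then 1 else 0) ≡ bit k → b ≡ isZero k
bit-sound true  zero    _ = refl
bit-sound false (suc _) _ = refl

isZero⇒ : ∀ k → isZero k ≡ true → k ≡ 0
isZero⇒ zero _ = refl

-- edge x v w = 0 holds iff (v , w) is an edge of the graphs with initial vertex x.
record Graphs : Set where
  field
    edge   : Fn 3
    irrefl : ∀ x v → fun edge (suc (suc x) ∷ v ∷ v ∷ []) ≢ 0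

Conforms : Graphs → Topology → Set
Conforms 𝒢 G = ∀ v w → E v w ≡ isZero (fun edge (toℕ x ∷ toℕ v ∷ toℕ w ∷ []))
  where
  open Graphs 𝒢
  open Topology G

module Family (𝒢 : Graphs) (encφ : Fn 1) where
  open Graphs 𝒢

  -- The arguments come in the order `w`, `v`, `x` because `tableFn` tabulates over the first one;
  -- `rowFn` likewise expects `v`, `n`, `x`.
  bitFn : Fn 3
  bitFn = call edge (var (# 2) ∷ var (# 1) ∷ var (# 0) ∷ []) ⟨0⟩ lit 1 ∣ lit 0

  rowFn : Fn 3
  rowFn = call (tableFn bitFn) (var (# 1) ∷ var (# 0) ∷ var (# 2) ∷ [])

  matrixFn : Fn 2
  matrixFn = call (tableFn rowFn) (var (# 0) ∷ var (# 0) ∷ var (# 1) ∷ [])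

  matrix : ℕ → ℕ → ℕ
  matrix n x = fun matrixFn (n ∷ x ∷ [])

  entry : ∀ {n} → ℕ → Fin n → Fin n → ℕ
  entry x v w = bit (fun edge (x ∷ toℕ v ∷ toℕ w ∷ []))

  row : ∀ {n} → (Fin n → Fin n → ℕ) → Fin n → ℕ
  row {n} h v = encList (mapₗ (h v) (allFin n))

  adjacency : ∀ {n} → (Fin n → Fin n → ℕ) → ℕ
  adjacency {n} h = encList (mapₗ (row h) (allFin n))

  matrix-adjacency : ∀ n x → matrix n x ≡ adjacency (entry {n} x)
  matrix-adjacency n x =
    trans (fun-tableFn rowFn n (n ∷ x ∷ []))
          (cong encList (map-cong (λ v → fun-tableFn bitFn n (toℕ v ∷ x ∷ [])) (allFin n)))

  run : ℕ → ℕ → ℕ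
  run n x = runNum n (x ∸ 2) (fun encφ (x ∸ 2 ∷ []))

  runFamilyFn : Fn 2
  runFamilyFn = call runFn (var (# 0) ∷ index ∷ call encφ (index ∷ []) ∷ [])
    where
    index : Fn 2
    index = call monusFn (var (# 1) ∷ lit 2 ∷ [])

  accept : ℕ
  accept = code (halt 1)

  defect : ℕ → ℕ → ℕ → ℕ
  defect n x m = dist m (matrix n x) + dist (run n x) accept

  defectFn : Fn 3
  defectFn = as3 (call distFn (var (# 2) ∷ call matrixFn (var (# 0) ∷ var (# 1) ∷ []) ∷ [])
                  ⊕ call distFn (call runFamilyFn (var (# 0) ∷ var (# 1) ∷ []) ∷ lit accept ∷ []))
                 defect (λ _ _ _ → refl)

  memberFn : Fn 1
  memberFn = as1 (call defectFn (call firstFn (var (# 0) ∷ [])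
                                 ∷ call firstFn (call secondFn (var (# 0) ∷ []) ∷ [])
                                 ∷ call secondFn (call secondFn (var (# 0) ∷ []) ∷ []) ∷ [])
                  ⟨0⟩ lit 1 ∣ lit 0)
                 (λ c → bit (defect (first c) (first (second c)) (second (second c))))
                 (λ _ → refl)

  -- Defined by the value of a program on the code of `G`, which makes computability immediate;
  -- `family⇒` and `⇒family` recover the intended meaning.
  family : ParamTopology
  family G = fun memberFn (encTop G ∷ []) ≡ 1

  family-computable : Computable encTop family
  family-computable = prog memberFn , λ G _ →
    (λ G∈ → subst (prog memberFn [ encTop G ∷ [] ]⇓_) G∈ (ok memberFn _)) ,
    (λ G∉ → subst (prog memberFn [ encTop G ∷ [] ]⇓_) (bit-≢1 _ G∉) (ok memberFn _))
    where
    bit-≢1 : ∀ k → bit k ≢ 1 → bit k ≡ 0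
    bit-≢1 zero    ≢1 = ⊥-elim (≢1 refl)
    bit-≢1 (suc _) ≢1 = refl

  -- The function `h` is arbitrary so that the rewriting touches the projections only.
  unpair-encTop : ∀ (h : ℕ → ℕ → ℕ → ℕ) a b c → let p = pair a (pair b c) in
                  h (first p) (first (second p)) (second (second p)) ≡ h a b c
  unpair-encTop h a b c rewrite second-pair a (pair b c) | first-pair a (pair b c)
                              | second-pair b c | first-pair b c = refl

  module _ (G : Topology) where
    open Topology G

    defectOf : ℕ
    defectOf = defect n (toℕ x) (adjacency (λ v w → if E v w then 1 else 0))

    member-defect : fun memberFn (encTop G ∷ []) ≡ bit defectOf
    member-defect = cong bit (unpair-encTop defect n (toℕ x) (adjacency (λ v w → if E v w then 1 else 0)))

    family⇒ : family G → Conforms 𝒢 G × run n (toℕ x) ≡ accept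
    family⇒ G∈ = graph , dist≡0 _ _ (m+n≡0⇒n≡0 (dist _ (matrix n (toℕ x))) zero-defect)
      where
      bit≡1 : ∀ k → bit k ≡ 1 → k ≡ 0
      bit≡1 zero _ = refl
      zero-defect : defectOf ≡ 0
      zero-defect = bit≡1 _ (trans (sym member-defect) G∈)
      graph : Conforms 𝒢 G
      -- Injectivity of the list encoding is used twice: for the list of rows and then inside row
      -- `v`.
      graph v w = bit-sound (E v w) _ (encList-map-injective _ _ (encList-map-injective _ _
        (trans (dist≡0 _ _ (m+n≡0⇒m≡0 _ zero-defect)) (matrix-adjacency n (toℕ x))) v) w)

    ⇒family : Conforms 𝒢 G → run n (toℕ x) ≡ accept → family G
    ⇒family graph halts = trans member-defect (cong bit
      (cong₂ _+_ (trans (cong (λ m → dist m (matrix n (toℕ x))) matrix≡) (dist-refl (matrix n (toℕ x))))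
                 (trans (cong (λ r → dist r accept) halts) (dist-refl accept))))
      where
      matrix≡ : adjacency (λ v w → if E v w then 1 else 0) ≡ matrix n (toℕ x)
      matrix≡ = trans (cong encList (map-cong (λ v → cong encList (map-cong (λ w →
                  trans (cong (λ b → if b then 1 else 0) (graph v w)) (bit-if _)) (allFin n))) (allFin n)))
                (sym (matrix-adjacency n (toℕ x)))

-- The diagonal argument

module Diagonal
  (𝒢 : Graphs) (encφ : Fn 1) {F : Set} (D : F → Set) (enc : F → ℕ) (sat : Topology → F → Set)
  (φ : ℕ → F) (φ∈D : ∀ x → D (φ x)) (encφ-φ : ∀ x → fun encφ (x ∷ []) ≡ enc (φ x))
  (holds : ∀ x G → Conforms 𝒢 G → toℕ (Topology.x G) ≢ 2 + x → sat G (φ x))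
  (fails : ∀ x G → Conforms 𝒢 G → toℕ (Topology.x G) ≡ 2 + x → ¬ sat G (φ x))
  where
  open Graphs 𝒢
  open Family 𝒢 encφ

  -- The shift by 2 keeps initial vertices in the range where `irrefl` is assumed. In the cycles and
  -- ladders the vertices above `2 + x` are isolated; they only make `n`, and with it the step
  -- bound, large.
  canonical : ∀ n x → 2 + x < n → Topology
  canonical n x x<n = record
    { n = n
    ; E = λ v w → isZero (fun edge (2 + x ∷ toℕ v ∷ toℕ w ∷ []))
    ; irrefl = λ v → isZero-≢0 _ (irrefl x (toℕ v))
    ; x = fromℕ< x<n
    }
    where
    isZero-≢0 : ∀ k → k ≢ 0 → isZero k ≡ false
    isZero-≢0 zero    ≢0 = ⊥-elim (≢0 refl)
    isZero-≢0 (suc _) _  = refl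

  -- If the diagonal formula were valid, `f` would return 1 on it; a large enough canonical graph
  -- would then lie in the family and refute the formula. So the formula is not valid and `f`
  -- returns 0. But then no graph with initial vertex `2 + index` passes the acceptance test, and
  -- the formula is valid after all.
  undecidable : ¬ ComputableOn D enc (λ f → ∀ G → family G → sat G f)
  undecidable (f , decides) = ¬valid valid
    where
    index : ℕ
    index = code ⌜ f ⌝

    formula : F
    formula = φ index

    run-steps : ∀ k → run k (2 + index) ≡ code (steps k (initial ⌜ f ⌝ (enc formula)))
    run-steps k = trans (runNum-code k ⌜ f ⌝ (fun encφ (index ∷ [])))
                        (cong (λ i → code (steps k (initial ⌜ f ⌝ i))) (encφ-φ index))

    refuted : ∀ k n → 2 + index < n → k ≤ n → steps k (initial ⌜ f ⌝ (enc formula)) ≡ halt 1 →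
              ¬ (∀ G → family G → sat G formula)
    refuted k n large k≤n halts valid =
      fails index G conforms (toℕ-fromℕ< large) (valid G (⇒family G conforms runs))
      where
      G : Topology
      G = canonical n index large
      conforms : Conforms 𝒢 G
      conforms v w = cong (λ x → isZero (fun edge (x ∷ toℕ v ∷ toℕ w ∷ []))) (sym (toℕ-fromℕ< large))
      runs : run n (toℕ (Topology.x G)) ≡ accept
      runs = trans (cong (run n) (toℕ-fromℕ< large))
                   (trans (run-steps n) (cong code (steps-halt halts k≤n)))

    ¬valid : ¬ (∀ G → family G → sat G formula)
    ¬valid valid with ⇓-steps (proj₁ (decides formula (φ∈D index)) valid)
    -- So many vertices leave room for the initial vertex `2 + index` and for the `k` steps until
    -- acceptance.
    ... | k , halts = refuted k (3 + index + k) (m≤m+n (3 + index) k) (m≤n+m k (3 + index)) halts valid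

    rejects : ∃ λ k → steps k (initial ⌜ f ⌝ (enc formula)) ≡ halt 0
    rejects = ⇓-steps (proj₂ (decides formula (φ∈D index)) ¬valid)

    valid : ∀ G → family G → sat G formula
    valid G G∈ with family⇒ G G∈
    -- Were `2 + index` the initial vertex, membership would make the run of `f` end with 1, against
    -- `rejects`.
    ... | conforms , runs = holds index G conforms λ x≡ →
      leaf≢node (halt-unique {k = proj₁ rejects} {l = Topology.n G} {y = 0} {z = 1} (proj₂ rejects)
        (code-injective _ _ (trans (sym (run-steps (Topology.n G)))
                                   (trans (cong (run (Topology.n G)) (sym x≡)) runs))))
      where
      leaf≢node : ∀ {s t} → leaf ≢ node s t
      leaf≢node ()

-- Bisimulations.

module Bisimulation
  {S T A : Set} (_⟶ˢ_ : S → S → Set) (_⟶ᵗ_ : T → T → Set) (I : A → S → Set) (J : A → T → Set)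
  (_~_ : S → T → Set)
  (forth : ∀ {s s' t} → s ~ t → s ⟶ˢ s' → Σ T λ t' → t ⟶ᵗ t' × s' ~ t')
  (back  : ∀ {s t t'} → s ~ t → t ⟶ᵗ t' → Σ S λ s' → s ⟶ˢ s' × s' ~ t')
  (atomˢᵗ : ∀ {s t} p → s ~ t → I p s → J p t)
  (atomᵗˢ : ∀ {s t} p → s ~ t → J p t → I p s)
  where
  module 𝒮 = Sem _⟶ˢ_ I
  module 𝒯 = Sem _⟶ᵗ_ J

  pathˢᵗ : ∀ {s t} → s ~ t → (π : ℕ → S) → 𝒮.IsPath s π →
           Σ (ℕ → T) λ σ → 𝒯.IsPath t σ × (∀ i → π i ~ σ i)
  pathˢᵗ {s} {t} s~t π (π0 , steps) = proj₁ ∘ go , (refl , next) , proj₂ ∘ go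
    where
    go : ∀ i → Σ T (π i ~_)
    go zero    = t , subst (_~ t) (sym π0) s~t
    go (suc i) = proj₁ (forth (proj₂ (go i)) (steps i)) , proj₂ (proj₂ (forth (proj₂ (go i)) (steps i)))
    next : ∀ i → proj₁ (go i) ⟶ᵗ proj₁ (go (suc i))
    next i = proj₁ (proj₂ (forth (proj₂ (go i)) (steps i)))

  pathᵗˢ : ∀ {s t} → s ~ t → (σ : ℕ → T) → 𝒯.IsPath t σ →
           Σ (ℕ → S) λ π → 𝒮.IsPath s π × (∀ i → π i ~ σ i)
  pathᵗˢ {s} {t} s~t σ (σ0 , steps) = proj₁ ∘ go , (refl , next) , proj₂ ∘ go
    where
    go : ∀ i → Σ S (_~ σ i)
    go zero    = s , subst (s ~_) (sym σ0) s~t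
    go (suc i) = proj₁ (back (proj₂ (go i)) (steps i)) , proj₂ (proj₂ (back (proj₂ (go i)) (steps i)))
    next : ∀ i → proj₁ (go i) ⟶ˢ proj₁ (go (suc i))
    next i = proj₁ (proj₂ (back (proj₂ (go i)) (steps i)))

  mutual
    -- The two transfers are mutual because negation reverses the direction. `EU` carries its
    -- witnessing path across; `AU` first pulls the given path back.
    satCˢᵗ : ∀ φ {s t} → s ~ t → 𝒮.satC s φ → 𝒯.satC t φ
    satCˢᵗ tt        s~t _ = _
    satCˢᵗ (atom p)  s~t h = atomˢᵗ p s~t h
    satCˢᵗ (neg φ)   s~t h = h ∘ satCᵗˢ φ s~t
    satCˢᵗ (and φ ψ) s~t (h , k) = satCˢᵗ φ s~t h , satCˢᵗ ψ s~t k
    satCˢᵗ (EU φ ψ)  s~t (π , π-path , j , h , before) with pathˢᵗ s~t π π-path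
    ... | σ , σ-path , π~σ =
      σ , σ-path , j , satCˢᵗ ψ (π~σ j) h , λ k k<j → satCˢᵗ φ (π~σ k) (before k k<j)
    satCˢᵗ (AU φ ψ)  s~t h σ σ-path with pathᵗˢ s~t σ σ-path
    ... | π , π-path , π~σ with h π π-path
    ... | j , h′ , before = j , satCˢᵗ ψ (π~σ j) h′ , λ k k<j → satCˢᵗ φ (π~σ k) (before k k<j)

    satCᵗˢ : ∀ φ {s t} → s ~ t → 𝒯.satC t φ → 𝒮.satC s φ
    satCᵗˢ tt        s~t _ = _
    satCᵗˢ (atom p)  s~t h = atomᵗˢ p s~t h
    satCᵗˢ (neg φ)   s~t h = h ∘ satCˢᵗ φ s~t
    satCᵗˢ (and φ ψ) s~t (h , k) = satCᵗˢ φ s~t h , satCᵗˢ ψ s~t k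
    satCᵗˢ (EU φ ψ)  s~t (σ , σ-path , j , h , before) with pathᵗˢ s~t σ σ-path
    ... | π , π-path , π~σ =
      π , π-path , j , satCᵗˢ ψ (π~σ j) h , λ k k<j → satCᵗˢ φ (π~σ k) (before k k<j)
    satCᵗˢ (AU φ ψ)  s~t h π π-path with pathˢᵗ s~t π π-path
    ... | σ , σ-path , π~σ with h σ σ-path
    ... | j , h′ , before = j , satCᵗˢ ψ (π~σ j) h′ , λ k k<j → satCᵗˢ φ (π~σ k) (before k k<j)

-- The memoryless relay process

pattern token = fzero
pattern idle  = fsuc fzero

holding : Fin 2 → Bool
holding token = true
holding idle  = false

relay : Template
relay = record
  { nQ    = 2
  ; nAP   = 1
  ; nInt  = 0
  ; isTok = holding
  ; lab   = λ q _ → holding q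
  ; δ     = δ
  ; ιt    = token
  ; ιn    = idle
  }
  where
  δ : Fin 2 → Act 0 → Fin 2 → Bool
  δ token snd idle  = true
  δ idle  rcv token = true
  δ _     _   _     = false

sends : ∀ q q' → Template.δ relay q snd q' ≡ true → q ≡ token × q' ≡ idle
sends token idle  _ = refl , refl
sends token token ()
sends idle  token ()
sends idle  idle  ()

receives : ∀ q q' → Template.δ relay q rcv q' ≡ true → q ≡ idle × q' ≡ token
receives idle  token _ = refl , refl
receives idle  idle  ()
receives token token ()
receives token idle  ()

relay-InPu : InPu relay
relay-InPu =
  (token , refl) , (idle , refl) , refl , refl ,
  (λ { token idle _ → refl , refl ; token token () ; idle token () ; idle idle () }) ,
  (λ { idle token _ → refl , refl ; token token () ; token idle () ; idle idle () }) ,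
  (λ _ _ ()) ,
  (λ { token → snd , idle , refl ; idle → rcv , token , refl }) ,
  blocks
  where
  step-token : ∀ q a q' → Template.δ relay q a q' ≡ true → q ≡ token → a ≡ snd × q' ≡ idle
  step-token token snd idle  _  _ = refl , refl
  step-token token snd token () _
  step-token token rcv idle  () _
  step-token token rcv token () _
  step-token idle  _   _     _  ()

  step-idle : ∀ q a q' → Template.δ relay q a q' ≡ true → q ≡ idle → a ≡ rcv × q' ≡ token
  step-idle idle  rcv token _  _ = refl , refl
  step-idle idle  rcv idle  () _
  step-idle idle  snd idle  () _
  step-idle idle  snd token () _
  step-idle token _   _     _  ()

  double : ℕ → ℕ
  double zero    = zero
  double (suc k) = suc (suc (double k))

  -- Without internal actions every block consists of its two letters only, so block `k` starts at
  -- `double k`.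
  alternating : ∀ c₁ c₂ (a : ℕ → Act 0) → (∀ k → a (double k) ≡ c₁ × a (suc (double k)) ≡ c₂) →
                InBlocks c₁ c₂ a
  alternating c₁ c₂ a alt = double , refl , λ k →
    suc (double k) , refl , proj₂ (alt k) , double k , ≤-refl , ≤-refl , proj₁ (alt k) ,
    λ i lo hi i≢ → ⊥-elim (i≢ (≤-antisym (s≤s⁻¹ hi) lo))

  blocks : ∀ s a → IsRun relay s a → InBlocks snd rcv a ⊎ InBlocks rcv snd a
  blocks s a (start , next) with start
  ... | inj₁ s0 = inj₁ (alternating snd rcv a λ k → proj₁ (two k (even k)) , proj₁ (proj₂ (two k (even k))))
    where
    two : ∀ k → s (double k) ≡ token →
          a (double k) ≡ snd × a (suc (double k)) ≡ rcv × s (double (suc k)) ≡ token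
    two k eq with step-token _ _ _ (next (double k)) eq
    ... | a≡ , eq′ with step-idle _ _ _ (next (suc (double k))) eq′
    ... | b≡ , eq″ = a≡ , b≡ , eq″
    even : ∀ k → s (double k) ≡ token
    even zero    = s0
    even (suc k) = proj₂ (proj₂ (two k (even k)))
  ... | inj₂ s0 = inj₂ (alternating rcv snd a λ k → proj₁ (two k (even k)) , proj₁ (proj₂ (two k (even k))))
    where
    two : ∀ k → s (double k) ≡ idle →
          a (double k) ≡ rcv × a (suc (double k)) ≡ snd × s (double (suc k)) ≡ idle
    two k eq with step-idle _ _ _ (next (double k)) eq
    ... | a≡ , eq′ with step-token _ _ _ (next (suc (double k))) eq′
    ... | b≡ , eq″ = a≡ , b≡ , eq″
    even : ∀ k → s (double k) ≡ idle
    even zero    = s0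
    even (suc k) = proj₂ (proj₂ (two k (even k)))

-- Since the process has no memory, its system on G is bisimilar to G itself.

module TokenGraph (G : Topology) where
  open Topology G
  open TPS relay G

  at : Fin n → GState
  at v u with u ≟ᶠ v
  ... | yes _ = token
  ... | no  _ = idle

  at-here : ∀ v → at v v ≡ token
  at-here v with v ≟ᶠ v
  ... | yes _  = refl
  ... | no v≢v = ⊥-elim (v≢v refl)

  at-other : ∀ {v u} → u ≢ v → at v u ≡ idle
  at-other {v} {u} u≢v with u ≟ᶠ v
  ... | yes u≡v = ⊥-elim (u≢v u≡v)
  ... | no  _   = refl

  at-token : ∀ {v u} → at v u ≡ token → u ≡ v
  at-token {v} {u} eq with u ≟ᶠ v
  ... | yes u≡v = u≡v
  at-token () | no _

  -- Global states are functions that `Step` constrains only pointwise, so they are compared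
  -- pointwise with `at v`.
  _~_ : GState → Fin n → Set
  s ~ v = ∀ u → s u ≡ at v u

  _⟶_ : Fin n → Fin n → Set
  v ⟶ w = E v w ≡ true

  init~ : initState ~ x
  init~ u with u ≟ᶠ x
  ... | yes _ = refl
  ... | no  _ = refl

  -- A sender must hold the token and is therefore `v`; there being no internal actions, a step
  -- amounts to the choice of an edge out of `v`.
  forth : ∀ {s s' v} → s ~ v → Step s s' → Σ (Fin n) λ w → v ⟶ w × s' ~ w
  forth s~v (internal _ () _ _)
  forth {s} {s'} {v} s~v (pass v′ w edge snd-v rcv-w rest)
    with sends _ _ snd-v | receives _ _ rcv-w
  ... | v′-token , v′-idle | w-idle , w-token = w , subst (_⟶ w) v′≡v edge , s'~w
    where
    v′≡v : v′ ≡ v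
    v′≡v = at-token (trans (sym (s~v v′)) v′-token)
    s'~w : s' ~ w
    s'~w u with u ≟ᶠ w
    ... | yes refl = w-token
    ... | no u≢w with u ≟ᶠ v′
    ...   | yes refl = v′-idle
    ...   | no u≢v′  = trans (rest u u≢v′ u≢w) (trans (s~v u) (at-other λ u≡v → u≢v′ (trans u≡v (sym v′≡v))))

  back : ∀ {s v w} → s ~ v → v ⟶ w → Σ GState λ s' → Step s s' × s' ~ w
  back {s} {v} {w} s~v edge = at w ,
    pass v w edge
      (subst₂ (λ q q' → Template.δ relay q snd q' ≡ true)
              (sym (trans (s~v v) (at-here v))) (sym (at-other v≢w)) refl)
      (subst₂ (λ q q' → Template.δ relay q rcv q' ≡ true)
              (sym (trans (s~v w) (at-other (v≢w ∘ sym)))) (sym (at-here w)) refl)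
      (λ u u≢v u≢w → trans (at-other u≢w) (sym (trans (s~v u) (at-other u≢v)))) ,
    λ _ → refl
    where
    v≢w : v ≢ w
    v≢w refl with trans (sym edge) (irrefl v)
    ... | ()

  At : ∀ {m} → (Fin m → Fin n) → Fin 1 × Fin m → Fin n → Set
  At ρ (_ , j) v = ρ j ≡ v

  holding-token : ∀ {q} → holding q ≡ true → q ≡ token
  holding-token {token} _ = refl
  holding-token {idle} ()

  module _ {m} (ρ : Fin m → Fin n) where
    atom⇒ : ∀ {s v} p → s ~ v → Atom ρ p s → At ρ p v
    atom⇒ (_ , j) s~v h = at-token (trans (sym (s~v (ρ j))) (holding-token h))

    atom⇐ : ∀ {s v} p → s ~ v → At ρ p v → Atom ρ p s
    atom⇐ (_ , j) s~v refl = cong holding (trans (s~v (ρ j)) (at-here (ρ j)))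

    open Bisimulation Step _⟶_ (Atom ρ) (At ρ) _~_ forth back atom⇒ atom⇐ public

-- Walks round the cycle X, X - 1, ..., 0, X

wrap : ℕ → ℕ → ℕ
wrap X zero    = X
wrap X (suc k) = k

orbit : ℕ → ℕ → ℕ → ℕ
orbit X k zero    = k
orbit X k (suc i) = wrap X (orbit X k i)

orbit≤ : ∀ {X k} i → k ≤ X → orbit X k i ≤ X
orbit≤ zero    k≤X = k≤X
orbit≤ {X} {k} (suc i) k≤X with orbit X k i | orbit≤ {X} {k} i k≤X
... | zero  | _    = ≤-refl
... | suc m | m<X  = <⇒≤ m<X

orbit-∸ : ∀ X i → i ≤ X → orbit X X i ≡ X ∸ i
orbit-∸ X zero    _   = refl
orbit-∸ X (suc i) i<X =
  cong (wrap X) (trans (orbit-∸ X i (<⇒≤ i<X)) (+-∸-assoc 1 i<X))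

orbit-period : ∀ X → orbit X X (suc X) ≡ X
orbit-period X = cong (wrap X) (trans (orbit-∸ X X ≤-refl) (n∸n≡0 X))

-- The edges are v → v - 1 for 0 < v ≤ x and the zeros of jump.
module Descending
  (jump : Fn 3) (jump-irrefl : ∀ x v → fun jump (2 + x ∷ v ∷ v ∷ []) ≢ 0)
  (jump-wrap : ∀ x → fun jump (2 + x ∷ 0 ∷ 2 + x ∷ []) ≡ 0) where

  graphs : Graphs
  graphs = record
    -- With zero as truth, the product is a disjunction: either the descent `v = w + 1` with
    -- `v ≤ x`, or a jump.
    { edge   = call mulFn ( call distFn (var (# 1) ∷ sucFn (var (# 2)) ∷ [])
                              ⊕ call monusFn (var (# 1) ∷ var (# 0) ∷ [])
                          ∷ jump′ ∷ [])
    ; irrefl = λ x v edge≡0 → irrefl x v (m*n≡0⇒m≡0∨n≡0 _ edge≡0)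
    }
    where
    jump′ : Fn 3
    jump′ = call jump (var (# 0) ∷ var (# 1) ∷ var (# 2) ∷ [])
    irrefl : ∀ x v → dist v (suc v) + (v ∸ (2 + x)) ≡ 0 ⊎ fun jump (2 + x ∷ v ∷ v ∷ []) ≡ 0 → ⊥
    irrefl x v (inj₁ eq) = 1+n≢n (sym (dist≡0 v (suc v) (m+n≡0⇒m≡0 _ eq)))
    irrefl x v (inj₂ eq) = jump-irrefl x v eq

  module On (G : Topology) (conforms : Conforms graphs G) where
    open Topology G
    open TokenGraph G

    X : ℕ
    X = toℕ x

    edge-cases : ∀ {v w} → v ⟶ w → (toℕ v ≡ suc (toℕ w) × toℕ v ≤ X) ⊎ fun jump (X ∷ toℕ v ∷ toℕ w ∷ []) ≡ 0
    edge-cases {v} {w} e =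
      map⊎ (λ eq → dist≡0 _ _ (m+n≡0⇒m≡0 _ eq) , m∸n≡0⇒m≤n (m+n≡0⇒n≡0 (dist (toℕ v) (suc (toℕ w))) eq)) id
        (m*n≡0⇒m≡0∨n≡0 _ (isZero⇒ _ (trans (sym (conforms v w)) e)))

    edge-jump : ∀ {v w} → fun jump (X ∷ toℕ v ∷ toℕ w ∷ []) ≡ 0 → v ⟶ w
    edge-jump {v} {w} eq = trans (conforms v w)
      (cong isZero (trans (cong (d *_) eq) (*-zeroʳ d)))
      where
      d : ℕ
      d = dist (toℕ v) (suc (toℕ w)) + (toℕ v ∸ X)

    edge-down : ∀ {v w} → toℕ v ≡ suc (toℕ w) → toℕ v ≤ X → v ⟶ w
    edge-down {v} {w} eq v≤X = trans (conforms v w)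
      (cong (λ d → isZero (d * fun jump (X ∷ toℕ v ∷ toℕ w ∷ [])))
            (cong₂ _+_ (trans (cong (λ k → dist k (suc (toℕ w))) eq) (dist-refl (suc (toℕ w)))) (m≤n⇒m∸n≡0 v≤X)))

    vertex : ∀ k → k ≤ X → Fin n
    vertex k k≤X = fromℕ< (≤-<-trans k≤X (toℕ<n x))

    toℕ-vertex : ∀ {k} (k≤X : k ≤ X) → toℕ (vertex k k≤X) ≡ k
    toℕ-vertex k≤X = toℕ-fromℕ< _

    module _ (large : 2 ≤ X) where
      edge-wrap : ∀ {v w} → toℕ v ≤ X → toℕ w ≡ wrap X (toℕ v) → v ⟶ w
      edge-wrap {v} {w} v≤X w≡ with toℕ v in v≡
      ... | suc k = edge-down (trans v≡ (cong suc (sym w≡))) (subst (_≤ X) (sym v≡) v≤X)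
      ... | zero  = edge-jump (subst₂ (λ i j → fun jump (X ∷ i ∷ j ∷ []) ≡ 0) (sym v≡) (sym w≡) (wrap-jump X large))
        where
        wrap-jump : ∀ k → 2 ≤ k → fun jump (k ∷ 0 ∷ k ∷ []) ≡ 0
        wrap-jump (suc (suc k)) (s≤s (s≤s _)) = jump-wrap k

      -- Paths in the semantics are infinite; circling for ever supplies one from each vertex up to
      -- `X`.
      walk : ∀ {k} → k ≤ X → ℕ → Fin n
      walk {k} k≤X i = vertex (orbit X k i) (orbit≤ i k≤X)

      toℕ-walk : ∀ {k} (k≤X : k ≤ X) i → toℕ (walk k≤X i) ≡ orbit X k i
      toℕ-walk k≤X i = toℕ-vertex (orbit≤ i k≤X)

      walk-edge : ∀ {k} (k≤X : k ≤ X) i → walk k≤X i ⟶ walk k≤X (suc i)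
      walk-edge k≤X i = edge-wrap (subst (_≤ X) (sym (toℕ-walk k≤X i)) (orbit≤ i k≤X))
        (trans (toℕ-walk k≤X (suc i)) (cong (wrap X) (sym (toℕ-walk k≤X i))))

      walk-start : ∀ v (v≤X : toℕ v ≤ X) → walk v≤X 0 ≡ v
      walk-start v v≤X = toℕ-injective (toℕ-walk v≤X 0)

-- A copy of the encodings of Defs over an opaque pairing, which keeps the conversion checker
-- from unfolding powers of two.

opaque
  ⟪_,_⟫ : ℕ → ℕ → ℕ
  ⟪_,_⟫ = pair

  pair≡⟪⟫ : ∀ a b → pair a b ≡ ⟪ a , b ⟫
  pair≡⟪⟫ a b = refl

pair≡ : ∀ a b {c d} → a ≡ c → b ≡ d → pair a b ≡ ⟪ c , d ⟫
pair≡ a b refl refl = pair≡⟪⟫ a b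

tagged≡ : ∀ k a b {c d} → a ≡ c → b ≡ d → pair k (pair a b) ≡ ⟪ k , ⟪ c , d ⟫ ⟫
tagged≡ k a b p q = pair≡ k (pair a b) refl (pair≡ a b p q)

infixr 5 _⊠_
_⊠_ : ∀ {n} → Fn n → Fn n → Fn n
f ⊠ g = call (as2 pairFn ⟪_,_⟫ pair≡⟪⟫) (f ∷ g ∷ [])

encLTLᵒ : {A : Set} → (A → ℕ) → LTL A → ℕ
encLTLᵒ e tt        = ⟪ 0 , 0 ⟫
encLTLᵒ e (atom p)  = ⟪ 1 , e p ⟫
encLTLᵒ e (neg φ)   = ⟪ 2 , encLTLᵒ e φ ⟫
encLTLᵒ e (and φ ψ) = ⟪ 3 , ⟪ encLTLᵒ e φ , encLTLᵒ e ψ ⟫ ⟫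
encLTLᵒ e (U φ ψ)   = ⟪ 4 , ⟪ encLTLᵒ e φ , encLTLᵒ e ψ ⟫ ⟫

encCTLᵒ : {A : Set} → (A → ℕ) → CTL A → ℕ
encCTLᵒ e tt        = ⟪ 0 , 0 ⟫
encCTLᵒ e (atom p)  = ⟪ 1 , e p ⟫
encCTLᵒ e (neg φ)   = ⟪ 2 , encCTLᵒ e φ ⟫
encCTLᵒ e (and φ ψ) = ⟪ 3 , ⟪ encCTLᵒ e φ , encCTLᵒ e ψ ⟫ ⟫
encCTLᵒ e (EU φ ψ)  = ⟪ 4 , ⟪ encCTLᵒ e φ , encCTLᵒ e ψ ⟫ ⟫
encCTLᵒ e (AU φ ψ)  = ⟪ 5 , ⟪ encCTLᵒ e φ , encCTLᵒ e ψ ⟫ ⟫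

encDomᵒ : ∀ {m} → Dom m → ℕ
encDomᵒ every      = ⟪ 0 , 0 ⟫
encDomᵒ (among js) = encDom (among js)
encDomᵒ (outOf j)  = ⟪ 2 , toℕ j ⟫

encIdxᵒ : ∀ {B : ℕ → Set} → (∀ {m} → B m → ℕ) → ∀ {m} → Indexed B m → ℕ
encIdxᵒ e (body b)      = ⟪ 0 , e b ⟫
encIdxᵒ e (quant q d φ) = ⟪ 1 , ⟪ encQu q , ⟪ encDomᵒ d , encIdxᵒ e φ ⟫ ⟫ ⟫

encAtomᵒ : ∀ {a m} → Fin a × Fin m → ℕ
encAtomᵒ (p , j) = ⟪ toℕ p , toℕ j ⟫

encLTL≡ : ∀ {A : Set} {e e' : A → ℕ} → (∀ p → e p ≡ e' p) → ∀ φ → encLTL e φ ≡ encLTLᵒ e' φ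
encLTL≡ eq tt = pair≡ 0 0 refl refl
encLTL≡ {e = e} eq (atom p)  = pair≡ 1 (e p) refl (eq p)
encLTL≡ {e = e} eq (neg φ)   = pair≡ 2 (encLTL e φ) refl (encLTL≡ eq φ)
encLTL≡ {e = e} eq (and φ ψ) = tagged≡ 3 (encLTL e φ) (encLTL e ψ) (encLTL≡ eq φ) (encLTL≡ eq ψ)
encLTL≡ {e = e} eq (U φ ψ)   = tagged≡ 4 (encLTL e φ) (encLTL e ψ) (encLTL≡ eq φ) (encLTL≡ eq ψ)

encCTL≡ : ∀ {A : Set} {e e' : A → ℕ} → (∀ p → e p ≡ e' p) → ∀ φ → encCTL e φ ≡ encCTLᵒ e' φ
encCTL≡ eq tt = pair≡ 0 0 refl refl
encCTL≡ {e = e} eq (atom p)  = pair≡ 1 (e p) refl (eq p)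
encCTL≡ {e = e} eq (neg φ)   = pair≡ 2 (encCTL e φ) refl (encCTL≡ eq φ)
encCTL≡ {e = e} eq (and φ ψ) = tagged≡ 3 (encCTL e φ) (encCTL e ψ) (encCTL≡ eq φ) (encCTL≡ eq ψ)
encCTL≡ {e = e} eq (EU φ ψ)  = tagged≡ 4 (encCTL e φ) (encCTL e ψ) (encCTL≡ eq φ) (encCTL≡ eq ψ)
encCTL≡ {e = e} eq (AU φ ψ)  = tagged≡ 5 (encCTL e φ) (encCTL e ψ) (encCTL≡ eq φ) (encCTL≡ eq ψ)

encDom≡ : ∀ {m} (d : Dom m) → encDom d ≡ encDomᵒ d
encDom≡ every      = pair≡ 0 0 refl refl
encDom≡ (among js) = refl
encDom≡ (outOf j)  = pair≡ 2 (toℕ j) refl refl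

encIdx≡ : ∀ {B : ℕ → Set} {e e' : ∀ {m} → B m → ℕ} → (∀ {m} (b : B m) → e b ≡ e' b) →
          ∀ {m} (φ : Indexed B m) → encIdx e φ ≡ encIdxᵒ e' φ
encIdx≡ {e = e} eq (body b) = pair≡ 0 (e b) refl (eq b)
encIdx≡ {e = e} {e'} eq (quant q d φ) =
  pair≡ 1 (pair (encQu q) (pair (encDom d) (encIdx e φ))) refl
    (tagged≡ (encQu q) (encDom d) (encIdx e φ) (encDom≡ d) (encIdx≡ {e = e} {e'} eq φ))

encAtom≡ : ∀ {a m} (p : Fin a × Fin m) → encAtom p ≡ encAtomᵒ p
encAtom≡ (p , j) = pair≡ (toℕ p) (toℕ j) refl refl

encIdxLTL≡ : ∀ {a} (φ : IdxLTL a) → encIdxLTL φ ≡ encIdxᵒ (encLTLᵒ encAtomᵒ) φ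
encIdxLTL≡ = encIdx≡ (encLTL≡ encAtom≡)

encIdxCTL≡ : ∀ {a} (φ : IdxCTL a) → encIdxCTL φ ≡ encIdxᵒ (encCTLᵒ encAtomᵒ) φ
encIdxCTL≡ = encIdx≡ (encCTL≡ encAtom≡)

-- Cycles and LTL

module Cycle = Descending (var (# 1) ⊕ call distFn (var (# 2) ∷ var (# 0) ∷ []))
  (λ x v eq → 1+n≢0 (trans (sym (dist≡0 v (2 + x) (m+n≡0⇒n≡0 v eq))) (m+n≡0⇒m≡0 v eq)))
  (λ x → dist-refl (2 + x))

-- Each new variable ranges over the out-neighbours of the one bound before it, so the variables
-- trace a walk. De Bruijn order lists it backwards: `fzero` is its last vertex.
walks : ∀ {B} m → Indexed B (suc m) → Indexed B 1
walks zero    φ = φ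
walks (suc m) φ = walks m (quant all∀ (outOf fzero) φ)

-- Splitting off the top index leaves the other conjuncts with their variable numbers, so the code
-- obeys a primitive recursion in `k` (`conjFn`).
conj : ∀ {A} k → (Fin k → LTL A) → LTL A
conj zero    f = tt
conj (suc k) f = and (f (fromℕ k)) (conj k (f ∘ inject₁))

tok : ∀ {m} → Fin m → LTL (Fin 1 × Fin m)
tok j = atom (fzero , j)

-- Evaluated at time 0, when the token is at `x`: the walk starts and ends at `x` and avoids it in
-- between. The graph is explored by the index quantifiers, without temporal operators.
firstReturn : ∀ m → LTL (Fin 1 × Fin (2 + m))
firstReturn m = and (tok fzero) (and (tok (fromℕ (suc m))) (conj m (λ i → neg (tok (fsuc (inject₁ i))))))

noReturn : ℕ → IdxLTL 1
noReturn m = quant all∀ every (walks (suc m) (body (neg (firstReturn m))))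

module _ (G : Topology) where
  open Topology G
  open TokenGraph G

  Walk : ∀ m → (Fin (suc m) → Fin n) → Set
  Walk zero    ρ = ⊤
  Walk (suc m) ρ = ρ (fsuc fzero) ⟶ ρ fzero × Walk m (ρ ∘ fsuc)

  module _ {B : ℕ → Set} (h : ∀ {m} → B m → (Fin m → Fin n) → Set) where

    walks-intro : ∀ m {φ} → (∀ ρ → Walk m ρ → satI G {B} h φ ρ) → ∀ ρ → satI G {B} h (walks m φ) ρ
    walks-intro zero    sat ρ = sat ρ _
    walks-intro (suc m) sat ρ = walks-intro m (λ ρ' w g edge → sat (extV g ρ') (edge , w)) ρ

    -- The quantifiers are instantiated one after another along `w`; indices count back from the end
    -- of the walk, whence `m ∸ toℕ i`.
    walks-elim : ∀ m {φ} (w : ℕ → Fin n) → (∀ i → w i ⟶ w (suc i)) →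
                 ∀ ρ → ρ fzero ≡ w 0 → satI G {B} h (walks m φ) ρ →
                 ∃ λ ρ' → (∀ i → ρ' i ≡ w (m ∸ toℕ i)) × satI G {B} h φ ρ'
    walks-elim zero    w edge ρ eq sat = ρ , (λ { fzero → eq }) , sat
    walks-elim (suc m) w edge ρ eq sat with walks-elim m w edge ρ eq sat
    ... | ρ' , on-w , sat′ = extV (w (suc m)) ρ' , (λ { fzero → refl ; (fsuc i) → on-w i }) ,
                             sat′ (w (suc m)) (subst (_⟶ w (suc m)) (sym (on-w fzero)) (edge m))

module _ {S A : Set} (Step : S → S → Set) (I : A → S → Set) where
  open Sem Step I

  conj-elim : ∀ {π t} k {f} → satL π t (conj k f) → ∀ i → satL π t (f i)
  conj-elim (suc k) (h , hs) i with view i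
  ... | ‵fromℕ         = h
  ... | ‵inj₁ {i = j} _ = conj-elim k hs j

  conj-intro : ∀ {π t} k {f} → (∀ i → satL π t (f i)) → satL π t (conj k f)
  conj-intro zero    hs = _
  conj-intro (suc k) hs = hs (fromℕ k) , conj-intro k (hs ∘ inject₁)

module _ (G : Topology) (conforms : Conforms Cycle.graphs G) where
  open Topology G
  open TokenGraph G
  open TPS relay G using (Step; Atom; initState; ⊨LTL)
  open Cycle.On G conforms

  cycle-edge : ∀ {v w} → v ⟶ w → toℕ v ≡ suc (toℕ w) × toℕ v ≤ X ⊎ toℕ v ≡ 0 × w ≡ x
  cycle-edge {v} {w} e = map⊎ id (λ eq → m+n≡0⇒m≡0 (toℕ v) eq ,
    toℕ-injective (dist≡0 (toℕ w) X (m+n≡0⇒n≡0 (toℕ v) eq))) (edge-cases e)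

  -- While `x` is avoided the closing edge cannot be taken, so every step descends by one.
  walk-down : ∀ m ρ → Walk G m ρ → ρ (fromℕ m) ≡ x → (∀ i → ρ (inject₁ i) ≢ x) → toℕ (ρ fzero) + m ≡ X
  walk-down zero    ρ _       start _     = trans (+-identityʳ _) (cong toℕ start)
  walk-down (suc m) ρ (e , w) start avoid with cycle-edge e
  ... | inj₂ (_ , eq) = ⊥-elim (avoid fzero eq)
  ... | inj₁ (eq , _) = trans (+-suc _ m)
          (trans (cong (_+ m) (sym eq)) (walk-down m (ρ ∘ fsuc) w start (avoid ∘ fsuc)))

  -- A descent into `x` would start at `X + 1`, so the last edge comes from 0. The `m` steps before
  -- it descend from `X` to 0.
  return-length : ∀ m ρ → Walk G (suc m) ρ → ρ fzero ≡ x → ρ (fromℕ (suc m)) ≡ x →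
                  (∀ (i : Fin m) → ρ (fsuc (inject₁ i)) ≢ x) → X ≡ m
  return-length m ρ (e , w) end start avoid with cycle-edge e | walk-down m (ρ ∘ fsuc) w start avoid
  ... | inj₂ (eq , _)  | sum = trans (sym sum) (cong (_+ m) eq)
  ... | inj₁ (eq , ≤X) | _   = ⊥-elim (1+n≰n (subst (_≤ X) (trans eq (cong (suc ∘ toℕ) end)) ≤X))

  noReturn-holds : ∀ m → X ≢ m → ⊨LTL (noReturn m)
  noReturn-holds m X≢m g _ = walks-intro G _ (suc m) avoids (extV g noV)
    where
    avoids : ∀ ρ → Walk G (suc m) ρ → Sem.satLsys Step (Atom ρ) initState (neg (firstReturn m))
    avoids ρ w π (π0 , _) (end , start , avoid) =
      X≢m (return-length m ρ w (here end) (here start) λ i eq → conj-elim Step (Atom ρ) m avoid i (there eq))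
      where
      here : ∀ {j} → Atom ρ (fzero , j) (π 0) → ρ j ≡ x
      here {j} h = atom⇒ ρ (fzero , j) (subst (_~ x) (sym π0) init~) h
      there : ∀ {j} → ρ j ≡ x → Atom ρ (fzero , j) (π 0)
      there {j} eq = atom⇐ ρ (fzero , j) (subst (_~ x) (sym π0) init~) eq

  -- The variables follow one turn round the cycle, `X + 1` steps from `x` to `x`. The same walk,
  -- continued for ever, gives the path on which the formula is refuted.
  noReturn-fails : 2 ≤ X → ¬ ⊨LTL (noReturn X)
  noReturn-fails large sat with walks-elim G (λ b ρ → Sem.satLsys Step (Atom ρ) initState b) (suc X)
      (walk large ≤-refl) (walk-edge large ≤-refl) (extV x noV) (sym (walk-start large x ≤-refl)) (sat x _)
  ... | ρ , on-walk , sat′ with pathᵗˢ ρ init~ (walk large ≤-refl) (walk-start large x ≤-refl , walk-edge large ≤-refl)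
  ... | π , (π0 , π-path) , π~ = sat′ π (π0 , π-path)
          ( there end , there start
          , conj-intro Step (Atom ρ) X λ i h → avoid i (here h))
    where
    init′ : π 0 ~ x
    init′ = subst (_~ x) (sym π0) init~
    here : ∀ {j} → Atom ρ (fzero , j) (π 0) → ρ j ≡ x
    here {j} = atom⇒ ρ (fzero , j) init′
    there : ∀ {j} → ρ j ≡ x → Atom ρ (fzero , j) (π 0)
    there {j} = atom⇐ ρ (fzero , j) init′
    toℕ-ρ : ∀ i → toℕ (ρ i) ≡ orbit X X (suc X ∸ toℕ i)
    toℕ-ρ i = trans (cong toℕ (on-walk i)) (toℕ-walk large ≤-refl (suc X ∸ toℕ i))
    end : ρ fzero ≡ x
    end = toℕ-injective (trans (toℕ-ρ fzero) (orbit-period X))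
    start : ρ (fromℕ (suc X)) ≡ x
    start = toℕ-injective (trans (toℕ-ρ (fromℕ (suc X)))
      (cong (orbit X X) (trans (cong (X ∸_) (toℕ-fromℕ X)) (n∸n≡0 X))))
    avoid : ∀ (i : Fin X) → ρ (fsuc (inject₁ i)) ≢ x
    -- Variable `i + 1` stands `X ∸ i` steps into the walk, at vertex `i`, which is below `X`.
    avoid i eq = <-irrefl (sym (trans (trans (cong toℕ (sym eq)) (toℕ-ρ (fsuc (inject₁ i))))
                                      (trans (orbit-∸ X k (m∸n≤m X (toℕ (inject₁ i)))) (m∸[m∸n]≡n (<⇒≤ i<X)))))
                          i<X
      where
      i<X : toℕ (inject₁ i) < X
      i<X = subst (_< X) (sym (toℕ-inject₁ i)) (toℕ<n i)
      k : ℕ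
      k = X ∸ toℕ (inject₁ i)

-- Computing the codes of the LTL formulas

conjFn : Fn 1
conjFn = recFn (lit 0 ⊠ lit 0) (lit 3 ⊠ (lit 2 ⊠ lit 1 ⊠ lit 0 ⊠ sucFn (var (# 0))) ⊠ var (# 1))

conj-code : ∀ {A : Set} (e : A → ℕ) k f → (∀ i → e (f i) ≡ ⟪ 0 , suc (toℕ i) ⟫) →
            fun conjFn (k ∷ []) ≡ encLTLᵒ e (conj k (λ i → neg (atom (f i))))
conj-code e zero    f eq = refl
conj-code e (suc k) f eq = cong₂ (λ p r → ⟪ 3 , ⟪ ⟪ 2 , ⟪ 1 , p ⟫ ⟫ , r ⟫ ⟫)
  (trans (cong (λ j → ⟪ 0 , suc j ⟫) (sym (toℕ-fromℕ k))) (sym (eq (fromℕ k))))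
  (conj-code e k (f ∘ inject₁) (λ i → trans (eq (inject₁ i)) (cong (λ j → ⟪ 0 , suc j ⟫) (toℕ-inject₁ i))))

outStepFn : Fn 1
outStepFn = lit 1 ⊠ lit 0 ⊠ (lit 2 ⊠ lit 0) ⊠ var (# 0)

walksFn : Fn 2
walksFn = recFn (var (# 0)) (call outStepFn (var (# 1) ∷ []))

-- `walks` hands the wrapped formula on as an accumulator, `walksFn` wraps the result of the
-- recursion; `commute` identifies these two iterations of `outStepFn`.
walks-code : ∀ {B : ℕ → Set} (e : ∀ {m} → B m → ℕ) m (φ : Indexed B (suc m)) →
             encIdxᵒ e (walks m φ) ≡ fun walksFn (m ∷ encIdxᵒ e φ ∷ [])
walks-code {B} e zero    φ = refl
walks-code {B} e (suc m) φ = trans (walks-code {B} e m _) (commute m (encIdxᵒ {B} e φ))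
  where
  commute : ∀ m c → fun walksFn (m ∷ fun outStepFn (c ∷ []) ∷ []) ≡ fun outStepFn (fun walksFn (m ∷ c ∷ []) ∷ [])
  commute zero    c = refl
  commute (suc m) c = cong (λ r → fun outStepFn (r ∷ [])) (commute m c)

noReturnFn : Fn 1
noReturnFn = lit 1 ⊠ lit 0 ⊠ (lit 0 ⊠ lit 0) ⊠ call walksFn
  ( sucFn m
  ∷ (lit 0 ⊠ lit 2 ⊠ lit 3 ⊠ (lit 1 ⊠ lit 0 ⊠ lit 0) ⊠ lit 3 ⊠ (lit 1 ⊠ lit 0 ⊠ sucFn m) ⊠ call conjFn (m ∷ []))
  ∷ [])
  where
  m : Fn 1
  m = sucFn (sucFn (var (# 0)))

noReturn-code : ∀ k → fun noReturnFn (k ∷ []) ≡ encIdxLTL (noReturn (2 + k))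
noReturn-code k = sym (trans (encIdxLTL≡ (noReturn m))
  (cong (λ c → ⟪ 1 , ⟪ 0 , ⟪ ⟪ 0 , 0 ⟫ , c ⟫ ⟫ ⟫)
    (trans (walks-code {λ m → LTL (Fin 1 × Fin m)} (encLTLᵒ encAtomᵒ) (suc m) (body (neg (firstReturn m))))
           (cong (λ c → fun walksFn (suc m ∷ c ∷ [])) body-code))))
  where
  m : ℕ
  m = 2 + k
  body-code : ⟪ 0 , encLTLᵒ encAtomᵒ (neg (firstReturn m)) ⟫ ≡ _
  body-code = cong₂ (λ i c → ⟪ 0 , ⟪ 2 , ⟪ 3 , ⟪ ⟪ 1 , ⟪ 0 , 0 ⟫ ⟫ , ⟪ 3 , ⟪ ⟪ 1 , ⟪ 0 , i ⟫ ⟫ , c ⟫ ⟫ ⟫ ⟫ ⟫ ⟫)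
    (toℕ-fromℕ (suc m)) (sym (conj-code encAtomᵒ m (λ i → fzero , fsuc (inject₁ i))
      (λ i → cong (λ j → ⟪ 0 , suc j ⟫) (toℕ-inject₁ i))))

LTL-undecidable : UndecidableLTL relay (Family.family Cycle.graphs noReturnFn)
LTL-undecidable = Diagonal.undecidable Cycle.graphs noReturnFn (λ _ → ⊤) encIdxLTL
  (TPS.⊨LTL relay) (λ k → noReturn (2 + k)) (λ _ → _) noReturn-code
  (λ k G conforms X≢ → noReturn-holds G conforms (2 + k) X≢)
  (λ k G conforms X≡ sat → noReturn-fails G conforms (subst (2 ≤_) (sym X≡) (s≤s (s≤s z≤n)))
    (subst (λ m → TPS.⊨LTL relay G (noReturn m)) (sym X≡) sat))

-- Ladders and CTL

parity-cases : ∀ k → parity k ≡ 0 ⊎ parity k ≡ 1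
parity-cases zero    = inj₁ refl
parity-cases (suc k) with parity k
... | zero  = inj₂ refl
... | suc _ = inj₁ refl

parity-suc : ∀ k → parity k ≢ parity (suc k)
parity-suc k eq with parity k
parity-suc k () | zero
parity-suc k () | suc _

-- Excludes a jump from `v` to itself: `parity v` is at most 1 and cannot bridge the gap of 2.
parity+v≢x : ∀ x v → 2 + v ≤ x → parity v + v ≢ x
parity+v≢x x v v<x eq with parity-cases v
... | inj₁ p = <⇒≢ (≤-trans (n≤1+n _) v<x) (trans (cong (_+ v) (sym p)) eq)
... | inj₂ p = <⇒≢ v<x (trans (cong (_+ v) (sym p)) eq)

-- The jump test vanishes when `2 + v ≤ x` and `parity v + w = x`; its instance `v = 0` is the
-- wrapping edge from 0 to `x`.
module Ladder = Descending
  (call monusFn (sucFn (sucFn (var (# 1))) ∷ var (# 0) ∷ [])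
    ⊕ call distFn (call parityFn (var (# 1) ∷ []) ⊕ var (# 2) ∷ var (# 0) ∷ []))
  (λ x v eq → parity+v≢x (2 + x) v (m∸n≡0⇒m≤n (m+n≡0⇒m≡0 (2 + v ∸ (2 + x)) eq))
                                  (dist≡0 (parity v + v) (2 + x) (m+n≡0⇒n≡0 (2 + v ∸ (2 + x)) eq)))
  (λ x → cong₂ _+_ (0∸n≡0 x) (dist-refl (2 + x)))

pattern outer = fsuc fzero
pattern inner = fzero

select : ℕ → Fin 2
select zero    = outer
select (suc _) = inner

toℕ-select : ∀ p → toℕ (select p) ≡ cond p 1 0
toℕ-select zero    = refl
toℕ-select (suc _) = refl

-- Names the target of the jump from vertex `k`, with `outer` standing for `x` and `inner` for its
-- predecessor in number.
label : ℕ → Fin 2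
label k = select (parity k)

tokᶜ : Fin 2 → CTL (Fin 1 × Fin 2)
tokᶜ j = atom (fzero , j)

EF : ∀ {A} → CTL A → CTL A
EF φ = EU tt φ

none : CTL (Fin 1 × Fin 2)
none = and (neg (tokᶜ outer)) (neg (tokᶜ inner))

-- `rung (suc k)` is true exactly at the vertices `v` with `k ≤ v` and `2 + v ≤ X` (`rung-elim`,
-- `rung-intro`): from there the token can descend to `k` and jump to the vertex that `label k`
-- names.
rung : ℕ → CTL (Fin 1 × Fin 2)
rung zero    = none
rung (suc k) = and none (EU (rung k) (tokᶜ (label k)))

-- At the initial state the first conjunct makes `outer` equal to `x`; the domain of `inner` in
-- `notExactly` then leaves only the vertex `X ∸ 1` (`out-of-x`). The other conjuncts say that
-- `2 + k ≤ X` but not `3 + k ≤ X`.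
exactly : ℕ → CTL (Fin 1 × Fin 2)
exactly k = and (tokᶜ outer) (and (EF (rung (suc k))) (neg (EF (rung (suc (suc k))))))

notExactly : ℕ → IdxCTL 1
notExactly k = quant all∀ every (quant all∀ (outOf fzero) (body (neg (exactly k))))

module _ {S A : Set} (Step : S → S → Set) (I : A → S → Set) where
  open Sem Step I

  EU-now : ∀ {s φ ψ} → Σ (ℕ → S) (IsPath s) → satC s ψ → satC s (EU φ ψ)
  EU-now {ψ = ψ} (π , π0 , π-path) h = π , (π0 , π-path) , 0 , subst (λ t → satC t ψ) (sym π0) h , λ _ ()

  EU-step : ∀ {s t φ ψ} → Step s t → satC s φ → satC t (EU φ ψ) → satC s (EU φ ψ)
  EU-step {s} {t} {φ} {ψ} s⟶t h (π , (π0 , π-path) , j , hψ , before) =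
    π′ , (refl , edges) , suc j , hψ , before′
    where
    π′ : ℕ → S
    π′ zero    = s
    π′ (suc i) = π i
    edges : ∀ i → Step (π′ i) (π′ (suc i))
    edges zero    = subst (Step s) (sym π0) s⟶t
    edges (suc i) = π-path i
    before′ : ∀ k → k < suc j → satC (π′ k) φ
    before′ zero    _         = h
    before′ (suc k) (s≤s k<j) = before k k<j

module _ (G : Topology) (conforms : Conforms Ladder.graphs G) where
  open Topology G
  open TokenGraph G
  open TPS relay G using (Step; Atom; initState; ⊨CTL)
  open Ladder.On G conforms

  ladder-edge : ∀ {v w} → v ⟶ w →
                toℕ v ≡ suc (toℕ w) × toℕ v ≤ X ⊎ 2 + toℕ v ≤ X × parity (toℕ v) + toℕ w ≡ X
  ladder-edge {v} {w} e = map⊎ id (λ eq → m∸n≡0⇒m≤n (m+n≡0⇒m≡0 (2 + toℕ v ∸ X) eq) ,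
    dist≡0 (parity (toℕ v) + toℕ w) X (m+n≡0⇒n≡0 (2 + toℕ v ∸ X) eq)) (edge-cases e)

  module _ (ρ : Fin 2 → Fin n) (outer≡ : ρ outer ≡ x) (inner≡ : suc (toℕ (ρ inner)) ≡ X) where
    open Sem _⟶_ (At ρ)

    parity-label : ∀ k → parity k + toℕ (ρ (label k)) ≡ X
    parity-label k with parity k | parity-cases k
    ... | .0 | inj₁ refl = cong toℕ outer≡
    ... | .1 | inj₂ refl = inner≡

    none-intro : ∀ {v} → 2 + toℕ v ≤ X → satC v none
    none-intro v≤X = (λ { refl → <⇒≱ v≤X (≤-trans (≤-reflexive (sym (cong toℕ outer≡))) (n≤1+n _)) }) ,
                     (λ { refl → <⇒≱ v≤X (≤-reflexive (sym inner≡)) })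

    none-elim : ∀ {v} → satC v none → toℕ v ≤ X → 2 + toℕ v ≤ X
    none-elim {v} (≢outer , ≢inner) v≤X =
      ≤∧≢⇒< (≤∧≢⇒< v≤X λ eq → ≢outer (trans outer≡ (toℕ-injective (sym eq))))
            λ eq → ≢inner (toℕ-injective (suc-injective (trans inner≡ (sym eq))))

    none-label : ∀ {v} k → satC v none → ρ (label k) ≢ v
    none-label k (≢outer , ≢inner) with parity k
    ... | zero  = ≢outer
    ... | suc _ = ≢inner

    rung-none : ∀ k {v} → satC v (rung k) → satC v none
    rung-none zero    h       = h
    rung-none (suc k) (h , _) = h

    -- Descents keep the path on unnamed vertices, so a jump must end it. It leaves from some `u`
    -- satisfying `rung k`, hence `u ≥ k ∸ 1` by induction on `k`; its target gives `u` the parity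
    -- of `k`, which excludes `k ∸ 1`.
    rung-elim : ∀ k {v} → satC v (rung (suc k)) → k ≤ toℕ v × 2 + toℕ v ≤ X
    rung-elim k {v} (h , π , (π0 , π-path) , j , end , before) =
      subst (λ u → k ≤ toℕ u × 2 + toℕ u ≤ X) π0
        (go j π π-path (subst (λ u → satC u none) (sym π0) h) end before)
      where
      go : ∀ j (π : ℕ → Fin n) → (∀ i → π i ⟶ π (suc i)) → satC (π 0) none → ρ (label k) ≡ π j →
           (∀ i → i < j → satC (π i) (rung k)) → k ≤ toℕ (π 0) × 2 + toℕ (π 0) ≤ X
      go zero    π π-path h end before = ⊥-elim (none-label k h end)
      go (suc j) π π-path h end before with ladder-edge (π-path 0)
      ... | inj₁ (eq , ≤X) =
        ≤-trans (proj₁ (go j (π ∘ suc) (π-path ∘ suc) (none-intro below) end (λ i i<j → before (suc i) (s≤s i<j))))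
                (≤-trans (n≤1+n _) (≤-reflexive (sym eq))) ,
        none-elim h ≤X
        where
        below : 2 + toℕ (π 1) ≤ X
        below = ≤-trans (s≤s (≤-reflexive (sym eq))) (<⇒≤ (none-elim h ≤X))
      go (suc zero) π π-path h end before | inj₂ (≤X , eq) = lower k (before 0 (s≤s z≤n)) same-parity , ≤X
        where
        same-parity : parity (toℕ (π 0)) ≡ parity k
        same-parity = +-cancelʳ-≡ (toℕ (π 1)) _ _
          (trans eq (trans (sym (parity-label k)) (cong (λ u → parity k + toℕ u) end)))
        lower : ∀ k → satC (π 0) (rung k) → parity (toℕ (π 0)) ≡ parity k → k ≤ toℕ (π 0)
        lower zero    _ _ = z≤n
        lower (suc k) r p = ≤∧≢⇒< (proj₁ (rung-elim k r)) λ k≡ → parity-suc k (trans (cong parity k≡) p)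
      -- A jump lands on a named vertex, where `rung k` fails, so no further edge can follow before
      -- the end.
      go (suc (suc j)) π π-path h end before | inj₂ (≤X , eq) =
        ⊥-elim (none-label (toℕ (π 0)) (rung-none k (before 1 (s≤s (s≤s z≤n))))
          (toℕ-injective (+-cancelˡ-≡ (parity (toℕ (π 0))) _ _ (trans (parity-label (toℕ (π 0))) (sym eq)))))

    module _ (large : 2 ≤ X) where
      path-from : ∀ {v} → toℕ v ≤ X → Σ (ℕ → Fin n) (IsPath v)
      path-from {v} v≤X = walk large v≤X , walk-start large v v≤X , walk-edge large v≤X

      label≤ : ∀ k → toℕ (ρ (label k)) ≤ X
      label≤ k = ≤-trans (m≤n+m _ (parity k)) (≤-reflexive (parity-label k))

      mutual
        rung-intro : ∀ k {v} → k ≤ toℕ v → 2 + toℕ v ≤ X → satC v (rung (suc k))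
        rung-intro k {v} k≤v v≤X = none-intro v≤X , climb k (toℕ v ∸ k) (sym (m∸n+n≡m k≤v)) v≤X

        -- Induction on the height `d` of `v` above `k`: descend to `k`, then jump. All vertices on
        -- the way are at least `k`, so `rung k` holds there.
        climb : ∀ k d {v} → toℕ v ≡ d + k → 2 + toℕ v ≤ X → satC v (EU (rung k) (tokᶜ (label k)))
        climb k zero {v} eq v≤X = EU-step _⟶_ (At ρ) {φ = rung k} {ψ = tokᶜ (label k)} (edge-jump jump≡0) (rung-at k (≤-reflexive (sym eq)) v≤X)
          (EU-now _⟶_ (At ρ) {φ = rung k} {ψ = tokᶜ (label k)} (path-from (label≤ k)) refl)
          where
          jump≡0 : (2 + toℕ v ∸ X) + dist (parity (toℕ v) + toℕ (ρ (label k))) X ≡ 0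
          jump≡0 = cong₂ _+_ (m≤n⇒m∸n≡0 v≤X)
            (trans (cong (λ d → dist d X) (trans (cong (λ i → parity i + toℕ (ρ (label k))) eq) (parity-label k)))
                   (dist-refl X))
        climb k (suc d) {v} eq v≤X = EU-step _⟶_ (At ρ) {t = vertex (d + k) w≤X} {φ = rung k} {ψ = tokᶜ (label k)}
          (edge-down (trans eq (cong suc (sym (toℕ-vertex w≤X)))) (≤-trans (m≤n+m _ 2) v≤X))
          (rung-at k (≤-trans (m≤n+m k (suc d)) (≤-reflexive (sym eq))) v≤X)
          (climb k d (toℕ-vertex w≤X) (subst (λ i → 2 + i ≤ X) (sym (toℕ-vertex w≤X)) (≤-trans (n≤1+n _) v≤X′)))
          where
          v≤X′ : 2 + suc (d + k) ≤ X
          v≤X′ = subst (λ i → 2 + i ≤ X) eq v≤X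
          w≤X : d + k ≤ X
          w≤X = ≤-trans (m≤n+m _ 3) v≤X′

        rung-at : ∀ k {v} → k ≤ toℕ v → 2 + toℕ v ≤ X → satC v (rung k)
        rung-at zero    _   v≤X = none-intro v≤X
        rung-at (suc k) k<v v≤X = rung-intro k (<⇒≤ k<v) v≤X

      -- Two descents lead from `x` through `inner` to `X ∸ 2`, the highest rung, which is at least
      -- `k`.
      EF-rung-intro : ∀ k → 2 + k ≤ X → satC x (EF (rung (suc k)))
      EF-rung-intro k k≤X =
        EU-step _⟶_ (At ρ) {t = ρ inner} {φ = tt} {ψ = rung (suc k)} (edge-down (sym inner≡) ≤-refl) _
          (EU-step _⟶_ (At ρ) {t = top} {φ = tt} {ψ = rung (suc k)} (edge-down inner-top inner≤) _
            (EU-now _⟶_ (At ρ) {φ = tt} {ψ = rung (suc k)} (path-from (≤-trans (m≤n+m _ 2) (≤-reflexive 2+top)))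
              (rung-intro k (s≤s⁻¹ (s≤s⁻¹ (≤-trans k≤X (≤-reflexive (sym 2+top))))) (≤-reflexive 2+top))))
        where
        top≤ : X ∸ 2 ≤ X
        top≤ = m∸n≤m X 2
        top : Fin n
        top = vertex (X ∸ 2) top≤
        2+top : 2 + toℕ top ≡ X
        2+top = trans (cong (2 +_) (toℕ-vertex top≤)) (m+[n∸m]≡n large)
        inner-top : toℕ (ρ inner) ≡ suc (toℕ top)
        inner-top = suc-injective (trans inner≡ (sym 2+top))
        inner≤ : toℕ (ρ inner) ≤ X
        inner≤ = ≤-trans (n≤1+n _) (≤-reflexive inner≡)

    EF-rung-elim : ∀ k {v} → satC v (EF (rung (suc k))) → 2 + k ≤ X
    EF-rung-elim k (_ , _ , _ , h , _) with rung-elim k h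
    ... | k≤v , v≤X = ≤-trans (s≤s (s≤s k≤v)) v≤X

  -- Jumps start at least two below `x`, so only the descending edge leaves `x`.
  out-of-x : ∀ {w} → x ⟶ w → suc (toℕ w) ≡ X
  out-of-x e with ladder-edge e
  ... | inj₁ (eq , _) = sym eq
  ... | inj₂ (≤X , _) = ⊥-elim (1+n≰n (≤-trans (n≤1+n _) ≤X))

  notExactly-holds : ∀ k → X ≢ 2 + k → ⊨CTL (notExactly k)
  notExactly-holds k X≢ g _ g′ e sat = absurd (satCˢᵗ ρ (exactly k) init~ sat)
    where
    ρ : Fin 2 → Fin n
    ρ = extV g′ (extV g noV)
    open Sem _⟶_ (At ρ)
    absurd : ¬ satC x (exactly k)
    -- The reachable rung gives `2 + k ≤ X`; if this were strict, the next rung would be reachable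
    -- too.
    absurd (refl , reach , ¬reach) with m≤n⇒m<n∨m≡n (EF-rung-elim ρ refl (out-of-x e) k reach)
    ... | inj₁ lt = ¬reach (EF-rung-intro ρ refl (out-of-x e) (≤-trans (s≤s (s≤s z≤n)) lt) (suc k) lt)
    ... | inj₂ eq = X≢ (sym eq)

  notExactly-fails : ∀ k → X ≡ 2 + k → ¬ ⊨CTL (notExactly k)
  notExactly-fails k X≡ sat = sat x _ b x⟶b (satCᵗˢ ρ (exactly k) init~
    ( refl
    , EF-rung-intro ρ refl (out-of-x x⟶b) (≤-trans (s≤s (s≤s z≤n)) (≤-reflexive (sym X≡))) k (≤-reflexive (sym X≡))
    , λ h → 1+n≰n (≤-trans (EF-rung-elim ρ refl (out-of-x x⟶b) (suc k) h) (≤-reflexive X≡))))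
    where
    b≤X : suc k ≤ X
    b≤X = ≤-trans (n≤1+n _) (≤-reflexive (sym X≡))
    b : Fin n
    b = vertex (suc k) b≤X
    x⟶b : x ⟶ b
    x⟶b = edge-down (trans X≡ (cong suc (sym (toℕ-vertex b≤X)))) ≤-refl
    ρ : Fin 2 → Fin n
    ρ = extV b (extV x noV)

-- Computing the codes of the CTL formulas

noneFn : ∀ {m} → Fn m
noneFn = lit 3 ⊠ (lit 2 ⊠ lit 1 ⊠ lit 0 ⊠ lit 1) ⊠ lit 2 ⊠ lit 1 ⊠ lit 0 ⊠ lit 0

rungFn : Fn 1
rungFn = recFn noneFn (lit 3 ⊠ noneFn ⊠ lit 4 ⊠ var (# 1) ⊠ lit 1 ⊠ lit 0 ⊠
                       (call parityFn (var (# 0) ∷ []) ⟨0⟩ lit 1 ∣ lit 0))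

rung-code : ∀ k → fun rungFn (k ∷ []) ≡ encCTLᵒ encAtomᵒ (rung k)
rung-code zero    = refl
rung-code (suc k) = cong₂ (λ r j → ⟪ 3 , ⟪ fun (noneFn {0}) [] , ⟪ 4 , ⟪ r , ⟪ 1 , ⟪ 0 , j ⟫ ⟫ ⟫ ⟫ ⟫ ⟫)
  (rung-code k) (sym (toℕ-select (parity k)))

-- The code of notExactly k, given the codes of its two rungs.
frameFn : Fn 2
frameFn = lit 1 ⊠ lit 0 ⊠ (lit 0 ⊠ lit 0) ⊠ lit 1 ⊠ lit 0 ⊠ (lit 2 ⊠ lit 0) ⊠
  lit 0 ⊠ lit 2 ⊠ lit 3 ⊠ (lit 1 ⊠ lit 0 ⊠ lit 1) ⊠ lit 3 ⊠
  (lit 4 ⊠ (lit 0 ⊠ lit 0) ⊠ var (# 0)) ⊠ lit 2 ⊠ lit 4 ⊠ (lit 0 ⊠ lit 0) ⊠ var (# 1)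

notExactlyFn : Fn 1
notExactlyFn = call frameFn ( call rungFn (sucFn (var (# 0)) ∷ [])
                            ∷ call rungFn (sucFn (sucFn (var (# 0))) ∷ []) ∷ [])

notExactly-code : ∀ k → fun notExactlyFn (k ∷ []) ≡ encIdxCTL (notExactly k)
notExactly-code k = sym (trans (encIdxCTL≡ (notExactly k))
  (cong₂ (λ r s → fun frameFn (r ∷ s ∷ [])) (sym (rung-code (suc k))) (sym (rung-code (suc (suc k))))))

CTL-undecidable : UndecidableCTL2 relay (Family.family Ladder.graphs notExactlyFn)
CTL-undecidable = Diagonal.undecidable Ladder.graphs notExactlyFn (λ φ → nq φ ≡ 2) encIdxCTL
  (TPS.⊨CTL relay) notExactly (λ _ → refl) notExactly-code
  (λ k G conforms X≢ → notExactly-holds G conforms k X≢)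
  (λ k G conforms X≡ → notExactly-fails G conforms k X≡)

theorem8 : Σ Template λ P → InPu P ×
    Σ ParamTopology λ 𝐆 → Σ ParamTopology λ 𝐇 →
    Computable encTop 𝐆 × Computable encTop 𝐇 ×
    UndecidableLTL P 𝐆 × UndecidableCTL2 P 𝐇
theorem8 =
  relay , relay-InPu ,
  Family.family Cycle.graphs noReturnFn , Family.family Ladder.graphs notExactlyFn ,
  Family.family-computable Cycle.graphs noReturnFn , Family.family-computable Ladder.graphs notExactlyFn ,
  LTL-undecidable , CTL-undecidable
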